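{- (a) $\mu(S_{n,k})$ is the largest root of the equation \[ x^{3}-x^{2}-(n-1)x+n-1-2k=0; \] (b) $\mu(S_{n,k})\leq\sqrt{n-1+k}$ for $n-1+k\geq 9$, and $\mu(S_{n,1})>\sqrt{n}$ for $4\leq n\leq 8$.
   Context: For a graph $G$, $\mu(G)$ denotes the spectral radius of its adjacency matrix. $S_{n,k}$ denotes the star of order $n$ with $k$ disjoint edges within its independent set (the set of its $n-1$ non-central vertices). That is, $S_{n,k}$ has vertices $1,\ldots,n$, vertex $1$ is adjacent to all the other vertices, and the only further edges are the $k$ pairwise disjoint edges $\{2,3\},\{4,5\},\ldots,\{2k,2k+1\}$ (so $0\leq 2k\leq n-1$).
   Formalization: Part (a) is stated for n ≥ 2 only: for n = 1, k = 0 the graph is a single vertex with μ = 0, while the equation x³ − x² = 0 has largest root 1, so the claim as written fails there. -}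

module Defs where

open import Algebra.Bundles using (CommutativeMonoid; CommutativeRing; RawRing)
import Algebra.Definitions.RawSemiring as RawSemiringOps
import Algebra.Properties.CommutativeSemigroup as CommutativeSemigroupProperties
import Algebra.Properties.Group as GroupProperties
import Algebra.Properties.Ring as RingProperties
open import Data.Bool.Base using (if_then_else_)
open import Data.Fin.Base using (Fin; toℕ)
open import Data.Fin.Properties using (any?)
open import Data.Integer.Base using (+_)
open import Data.Nat.Base as ℕ using (ℕ)
import Data.Nat.Properties as ℕ
open import Data.Product.Base using (_×_; _,_; ∃-syntax)
open import Data.Rational.Base as ℚ using (ℚ; 0ℚ; 1ℚ; ½; ∣_∣; 1/_)
import Data.Rational.Properties as ℚ
open import Data.Sum.Base using (_⊎_; inj₁; inj₂; [_,_]; swap)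
open import Data.Vec.Functional using (Vector)
open import Level using (0ℓ)
open import Relation.Binary.Core using (Rel)
open import Relation.Binary.Definitions
  using (Decidable; Irreflexive; Symmetric)
open import Relation.Binary.PropositionalEquality
  using (_≡_; refl; sym; trans; cong; cong₂; subst; module ≡-Reasoning)
open import Relation.Nullary using (¬_; does)
open import Relation.Nullary.Decidable using (_×-dec_; _⊎-dec_)

------------------------------------------------------------------------
-- Real numbers: Cauchy sequences of rationals, compared up to null
-- sequences (_≈_ below).

Eventually : (ℕ → Set) → Set
Eventually P = ∃[ N ] (∀ n → N ℕ.≤ n → P n)

IsCauchy : (ℕ → ℚ) → Set
IsCauchy x = ∀ ε → 0ℚ ℚ.< ε →
  ∃[ N ] (∀ m n → N ℕ.≤ m → N ℕ.≤ n → ∣ x m ℚ.- x n ∣ ℚ.< ε)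

record ℝ : Set where
  field
    seq    : ℕ → ℚ
    cauchy : IsCauchy seq

open ℝ public

abstract
  half-sum : ∀ ε → ½ ℚ.* ε ℚ.+ ½ ℚ.* ε ≡ ε
  half-sum ε = trans (sym (ℚ.*-distribʳ-+ ε ½ ½)) (ℚ.*-identityˡ ε)

  half-pos : ∀ {ε} → 0ℚ ℚ.< ε → 0ℚ ℚ.< ½ ℚ.* ε
  half-pos {ε} 0<ε =
    subst (ℚ._< ½ ℚ.* ε) (ℚ.*-zeroʳ ½) (ℚ.*-monoʳ-<-pos ½ 0<ε)

  cancel-mid : ∀ a b → b ℚ.+ (a ℚ.- b) ≡ a
  cancel-mid a b = trans (ℚ.+-comm b (a ℚ.- b)) (//-rightDividesˡ b a)
    where open GroupProperties ℚ.+-0-group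

  +-rearrange : ∀ a b c d →
    (a ℚ.+ b) ℚ.- (c ℚ.+ d) ≡ (a ℚ.- c) ℚ.+ (b ℚ.- d)
  +-rearrange a b c d =
    trans (cong (a ℚ.+ b ℚ.+_) (ℚ.neg-distrib-+ c d))
          (interchange a b (ℚ.- c) (ℚ.- d))
    where
    open CommutativeSemigroupProperties
      (CommutativeMonoid.commutativeSemigroup ℚ.+-0-commutativeMonoid)

  neg-rearrange : ∀ a b → ℚ.- a ℚ.- ℚ.- b ≡ ℚ.- (a ℚ.- b)
  neg-rearrange a b = sym (ℚ.neg-distrib-+ a (ℚ.- b))

  *-rearrange : ∀ a b c d →
    (a ℚ.* b) ℚ.- (c ℚ.* d) ≡ a ℚ.* (b ℚ.- d) ℚ.+ d ℚ.* (a ℚ.- c)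
  *-rearrange a b c d = sym (begin
    a ℚ.* (b ℚ.- d) ℚ.+ d ℚ.* (a ℚ.- c)
      ≡⟨ cong₂ ℚ._+_ (x[y-z]≈xy-xz a b d)
           (trans (ℚ.*-comm d (a ℚ.- c)) ([y-z]x≈yx-zx d a c)) ⟩
    (a ℚ.* b ℚ.- a ℚ.* d) ℚ.+ (a ℚ.* d ℚ.- c ℚ.* d)
      ≡⟨ sym (ℚ.+-assoc (a ℚ.* b ℚ.- a ℚ.* d) (a ℚ.* d) (ℚ.- (c ℚ.* d))) ⟩
    (a ℚ.* b ℚ.- a ℚ.* d) ℚ.+ a ℚ.* d ℚ.- c ℚ.* d
      ≡⟨ cong (ℚ._- c ℚ.* d) (//-rightDividesˡ (a ℚ.* d) (a ℚ.* b)) ⟩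
    a ℚ.* b ℚ.- c ℚ.* d
      ∎)
    where
    open ≡-Reasoning
    open GroupProperties ℚ.+-0-group using (//-rightDividesˡ)
    open RingProperties (CommutativeRing.ring ℚ.+-*-commutativeRing)
      using (x[y-z]≈xy-xz; [y-z]x≈yx-zx)

  const-cauchy : ∀ q → IsCauchy (λ _ → q)
  const-cauchy q ε 0<ε = 0 , λ _ _ _ _ →
    subst (ℚ._< ε) (sym (cong ∣_∣ (ℚ.+-inverseʳ q))) 0<ε

  neg-cauchy : ∀ x → IsCauchy x → IsCauchy (λ n → ℚ.- x n)
  neg-cauchy x cx ε 0<ε with cx ε 0<ε
  ... | N , f = N , λ m n N≤m N≤n →
    subst (ℚ._< ε)
      (sym (trans (cong ∣_∣ (neg-rearrange (x m) (x n)))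
                  (ℚ.∣-p∣≡∣p∣ (x m ℚ.- x n))))
      (f m n N≤m N≤n)

  +-cauchy : ∀ x y → IsCauchy x → IsCauchy y → IsCauchy (λ n → x n ℚ.+ y n)
  +-cauchy x y cx cy ε 0<ε
    with cx (½ ℚ.* ε) (half-pos 0<ε) | cy (½ ℚ.* ε) (half-pos 0<ε)
  ... | M , f | N , g = M ℕ.⊔ N , λ m n p q → begin-strict
    ∣ (x m ℚ.+ y m) ℚ.- (x n ℚ.+ y n) ∣
      ≡⟨ cong ∣_∣ (+-rearrange (x m) (y m) (x n) (y n)) ⟩
    ∣ (x m ℚ.- x n) ℚ.+ (y m ℚ.- y n) ∣
      ≤⟨ ℚ.∣p+q∣≤∣p∣+∣q∣ (x m ℚ.- x n) (y m ℚ.- y n) ⟩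
    ∣ x m ℚ.- x n ∣ ℚ.+ ∣ y m ℚ.- y n ∣
      <⟨ ℚ.+-mono-<
           (f m n (ℕ.m⊔n≤o⇒m≤o M N p) (ℕ.m⊔n≤o⇒m≤o M N q))
           (g m n (ℕ.m⊔n≤o⇒n≤o M N p) (ℕ.m⊔n≤o⇒n≤o M N q)) ⟩
    ½ ℚ.* ε ℚ.+ ½ ℚ.* ε
      ≡⟨ half-sum ε ⟩
    ε ∎
    where open ℚ.≤-Reasoning

  bounded : ∀ x → IsCauchy x →
    ∃[ B ] (ℚ.Positive B × Eventually (λ n → ∣ x n ∣ ℚ.≤ B))
  bounded x cx with cx 1ℚ (ℚ.positive⁻¹ 1ℚ)
  ... | N , f = ∣ x N ∣ ℚ.+ 1ℚ ,
    ℚ.positive (ℚ.≤-<-trans (ℚ.0≤∣p∣ (x N))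
      (subst (ℚ._< ∣ x N ∣ ℚ.+ 1ℚ) (ℚ.+-identityʳ ∣ x N ∣)
        (ℚ.+-monoʳ-< ∣ x N ∣ (ℚ.positive⁻¹ 1ℚ)))) ,
    N , λ n N≤n → begin
      ∣ x n ∣                      ≡⟨ cong ∣_∣ (sym (cancel-mid (x n) (x N))) ⟩
      ∣ x N ℚ.+ (x n ℚ.- x N) ∣    ≤⟨ ℚ.∣p+q∣≤∣p∣+∣q∣ (x N) (x n ℚ.- x N) ⟩
      ∣ x N ∣ ℚ.+ ∣ x n ℚ.- x N ∣  ≤⟨ ℚ.+-monoʳ-≤ ∣ x N ∣
                                        (ℚ.<⇒≤ (f n N N≤n ℕ.≤-refl)) ⟩
      ∣ x N ∣ ℚ.+ 1ℚ               ∎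
    where open ℚ.≤-Reasoning

  -- If |a| ≤ B and y varies by less than δ/B, then ay varies by less than δ.
  scale : ∀ δ → 0ℚ ℚ.< δ → ∀ B → .{{ℚ.Positive B}} →
    ∃[ η ] (0ℚ ℚ.< η ×
      (∀ a d → ∣ a ∣ ℚ.≤ B → ∣ d ∣ ℚ.< η → ∣ a ℚ.* d ∣ ℚ.< δ))
  scale δ 0<δ B = η , 0<η , λ a d a≤B d<η → begin-strict
    ∣ a ℚ.* d ∣          ≡⟨ ℚ.∣p*q∣≡∣p∣*∣q∣ a d ⟩
    ∣ a ∣ ℚ.* ∣ d ∣      ≤⟨ ℚ.*-monoʳ-≤-nonNeg ∣ d ∣ {{ℚ.∣-∣-nonNeg d}} a≤B ⟩
    B ℚ.* ∣ d ∣          <⟨ ℚ.*-monoʳ-<-pos B d<η ⟩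
    B ℚ.* η              ≡⟨ sym (ℚ.*-assoc B B⁻¹ δ) ⟩
    (B ℚ.* B⁻¹) ℚ.* δ    ≡⟨ cong (ℚ._* δ) (ℚ.*-inverseʳ B) ⟩
    1ℚ ℚ.* δ             ≡⟨ ℚ.*-identityˡ δ ⟩
    δ                    ∎
    where
    open ℚ.≤-Reasoning
    instance
      B≢0 : ℚ.NonZero B
      B≢0 = ℚ.pos⇒nonZero B
    B⁻¹ η : ℚ
    B⁻¹ = 1/ B
    η   = B⁻¹ ℚ.* δ
    0<η : 0ℚ ℚ.< η
    0<η = subst (ℚ._< η) (ℚ.*-zeroʳ B⁻¹)
            (ℚ.*-monoʳ-<-pos B⁻¹ {{ℚ.1/pos⇒pos B}} 0<δ)

  *-cauchy : ∀ x y → IsCauchy x → IsCauchy y → IsCauchy (λ n → x n ℚ.* y n)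
  *-cauchy x y cx cy ε 0<ε =
    let A , A>0 , Nx , x≤A = bounded x cx
        B , B>0 , Ny , y≤B = bounded y cy
        η , 0<η , small-y  = scale (½ ℚ.* ε) (half-pos 0<ε) A {{A>0}}
        θ , 0<θ , small-x  = scale (½ ℚ.* ε) (half-pos 0<ε) B {{B>0}}
        M , g = cy η 0<η
        N , f = cx θ 0<θ
    in (Nx ℕ.⊔ Ny) ℕ.⊔ (M ℕ.⊔ N) , λ m n p q →
    let p₁ = ℕ.m⊔n≤o⇒m≤o (Nx ℕ.⊔ Ny) (M ℕ.⊔ N) p
        p₂ = ℕ.m⊔n≤o⇒n≤o (Nx ℕ.⊔ Ny) (M ℕ.⊔ N) p
        q₁ = ℕ.m⊔n≤o⇒m≤o (Nx ℕ.⊔ Ny) (M ℕ.⊔ N) q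
        q₂ = ℕ.m⊔n≤o⇒n≤o (Nx ℕ.⊔ Ny) (M ℕ.⊔ N) q
    in begin-strict
    ∣ x m ℚ.* y m ℚ.- x n ℚ.* y n ∣
      ≡⟨ cong ∣_∣ (*-rearrange (x m) (y m) (x n) (y n)) ⟩
    ∣ x m ℚ.* (y m ℚ.- y n) ℚ.+ y n ℚ.* (x m ℚ.- x n) ∣
      ≤⟨ ℚ.∣p+q∣≤∣p∣+∣q∣ (x m ℚ.* (y m ℚ.- y n)) (y n ℚ.* (x m ℚ.- x n)) ⟩
    ∣ x m ℚ.* (y m ℚ.- y n) ∣ ℚ.+ ∣ y n ℚ.* (x m ℚ.- x n) ∣
      <⟨ ℚ.+-mono-<
           (small-y (x m) (y m ℚ.- y n) (x≤A m (ℕ.m⊔n≤o⇒m≤o Nx Ny p₁))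
             (g m n (ℕ.m⊔n≤o⇒m≤o M N p₂) (ℕ.m⊔n≤o⇒m≤o M N q₂)))
           (small-x (y n) (x m ℚ.- x n) (y≤B n (ℕ.m⊔n≤o⇒n≤o Nx Ny q₁))
             (f m n (ℕ.m⊔n≤o⇒n≤o M N p₂) (ℕ.m⊔n≤o⇒n≤o M N q₂))) ⟩
    ½ ℚ.* ε ℚ.+ ½ ℚ.* ε
      ≡⟨ half-sum ε ⟩
    ε ∎
    where open ℚ.≤-Reasoning

fromℚ : ℚ → ℝ
seq    (fromℚ q) _ = q
cauchy (fromℚ q)   = const-cauchy q

fromℕ : ℕ → ℝ
fromℕ n = fromℚ (+ n ℚ./ 1)

0ℝ 1ℝ : ℝ
0ℝ = fromℚ 0ℚ
1ℝ = fromℚ 1ℚ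

infix  8 -_
infixl 7 _*_
infixl 6 _+_ _-_
infix  4 _≈_ _≤_ _<_

-_ : ℝ → ℝ
seq    (- x) n = ℚ.- seq x n
cauchy (- x)   = neg-cauchy (seq x) (cauchy x)

_+_ _*_ _-_ : ℝ → ℝ → ℝ

seq    (x + y) n = seq x n ℚ.+ seq y n
cauchy (x + y)   = +-cauchy (seq x) (seq y) (cauchy x) (cauchy y)

seq    (x * y) n = seq x n ℚ.* seq y n
cauchy (x * y)   = *-cauchy (seq x) (seq y) (cauchy x) (cauchy y)

x - y = x + (- y)

_≈_ _≤_ _<_ : Rel ℝ 0ℓ
x ≈ y = ∀ ε → 0ℚ ℚ.< ε → Eventually λ n → ∣ seq x n ℚ.- seq y n ∣ ℚ.< ε
x ≤ y = ∀ ε → 0ℚ ℚ.< ε → Eventually λ n → seq x n ℚ.< seq y n ℚ.+ ε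
x < y = ∃[ ε ] (0ℚ ℚ.< ε × Eventually λ n → seq x n ℚ.+ ε ℚ.< seq y n)

ℝ-rawRing : RawRing 0ℓ 0ℓ
ℝ-rawRing = record
  { Carrier = ℝ ; _≈_ = _≈_
  ; _+_ = _+_ ; _*_ = _*_ ; -_ = -_ ; 0# = 0ℝ ; 1# = 1ℝ }

open RawSemiringOps (RawRing.rawSemiring ℝ-rawRing) public using (_^_)

-- s = √x
IsSqrt : ℝ → ℝ → Set
IsSqrt x s = 0ℝ ≤ s × s * s ≈ x

IsRoot : (ℝ → ℝ) → ℝ → Set
IsRoot f x = f x ≈ 0ℝ

IsLargestRoot : (ℝ → ℝ) → ℝ → Set
IsLargestRoot f x = IsRoot f x × (∀ y → IsRoot f y → y ≤ x)

------------------------------------------------------------------------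
-- Complex numbers

record ℂ : Set where
  constructor _+i_
  field
    re im : ℝ

open ℂ public

ℂ-rawRing : RawRing 0ℓ 0ℓ
ℂ-rawRing = record
  { Carrier = ℂ
  ; _≈_ = λ z w → re z ≈ re w × im z ≈ im w
  ; _+_ = λ z w → (re z + re w) +i (im z + im w)
  ; _*_ = λ z w → (re z * re w - im z * im w) +i (re z * im w + im z * re w)
  ; -_  = λ z → (- re z) +i (- im z)
  ; 0#  = 0ℝ +i 0ℝ
  ; 1#  = 1ℝ +i 0ℝ
  }

module ℂᵣ where
  open RawRing ℂ-rawRing public
  open RawSemiringOps rawSemiring public using (sum)

-- r = |z|
IsModulus : ℂ → ℝ → Set
IsModulus z r = IsSqrt (re z * re z + im z * im z) r

------------------------------------------------------------------------
-- Eigenvalues and the spectral radius of a square matrix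

Matrix : ℕ → Set
Matrix n = Fin n → Fin n → ℂ

_·_ : ∀ {n} → Matrix n → Vector ℂ n → Vector ℂ n
(M · v) i = ℂᵣ.sum λ j → M i j ℂᵣ.* v j

IsEigenvalue : ∀ {n} → Matrix n → ℂ → Set
IsEigenvalue {n} M z = ∃[ v ]
  (¬ (∀ i → v i ℂᵣ.≈ ℂᵣ.0#) × (∀ i → (M · v) i ℂᵣ.≈ z ℂᵣ.* v i))

-- ρ is the maximum of |z| over the eigenvalues z of M.
IsSpectralRadius : ∀ {n} → Matrix n → ℝ → Set
IsSpectralRadius M ρ =
    (∃[ z ] (IsEigenvalue M z × IsModulus z ρ))
  × (∀ z → IsEigenvalue M z → ∃[ r ] (IsModulus z r × r ≤ ρ))

------------------------------------------------------------------------
-- Finite simple graphs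

record Graph (n : ℕ) : Set₁ where
  field
    Adj    : Rel (Fin n) 0ℓ
    adj?   : Decidable Adj
    symm   : Symmetric Adj
    irrefl : Irreflexive _≡_ Adj

adjacencyMatrix : ∀ {n} → Graph n → Matrix n
adjacencyMatrix G i j = if does (Graph.adj? G i j) then ℂᵣ.1# else ℂᵣ.0#

-- The spectral radius of a graph, as a relation: Isμ G ρ says μ(G) = ρ.
Isμ : ∀ {n} → Graph n → ℝ → Set
Isμ G = IsSpectralRadius (adjacencyMatrix G)

------------------------------------------------------------------------
-- The graphs S n k

-- Edges {u , v}, u < v, with vertices numbered from 1.  The chords are
-- {2i , 2i+1} for i = 1, …, k.
SpokeOrChord : ℕ → Rel ℕ 0ℓ
SpokeOrChord k u v =
    (u ≡ 1 × 1 ℕ.< v)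
  ⊎ (∃[ t ] let i = ℕ.suc (toℕ {k} t) in u ≡ 2 ℕ.* i × v ≡ 2 ℕ.* i ℕ.+ 1)

spokeOrChord? : ∀ k → Decidable (SpokeOrChord k)
spokeOrChord? k u v =
  ((u ℕ.≟ 1) ×-dec (1 ℕ.<? v))
  ⊎-dec any? λ t → let i = ℕ.suc (toℕ {k} t) in
                   (u ℕ.≟ 2 ℕ.* i) ×-dec (v ℕ.≟ 2 ℕ.* i ℕ.+ 1)

spokeOrChord⇒< : ∀ {k u v} → SpokeOrChord k u v → u ℕ.< v
spokeOrChord⇒< (inj₁ (refl , 1<v))       = 1<v
spokeOrChord⇒< (inj₂ (t , refl , refl)) = ℕ.m<m+n _ ℕ.z<s

-- The vertex numbered u in 1, …, n is the element u ∸ 1 of Fin n.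
number : ∀ {n} → Fin n → ℕ
number i = ℕ.suc (toℕ i)

-- This is S_{n,k} when 2k < n.
S : (n k : ℕ) → Graph n
S n k = record
  { Adj    = λ i j → SpokeOrChord k (number i) (number j)
                   ⊎ SpokeOrChord k (number j) (number i)
  ; adj?   = λ i j → spokeOrChord? k (number i) (number j)
                     ⊎-dec spokeOrChord? k (number j) (number i)
  ; symm   = swap
  ; irrefl = λ { refl → [ (λ e → ℕ.<-irrefl refl (spokeOrChord⇒< e))
                        , (λ e → ℕ.<-irrefl refl (spokeOrChord⇒< e)) ] }
  }

-- x³ − x² − (n−1)x + n − 1 − 2k
cubic : (n k : ℕ) → ℝ → ℝ
cubic n k x =
  x ^ 3 - x ^ 2 - (fromℕ n - 1ℝ) * x + fromℕ n - 1ℝ - fromℕ (2 ℕ.* k)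

{-# OPTIONS --safe #-}

-- The vector with entries x(x − 1) at the centre, x on the chords and x − 1 elsewhere is an
-- eigenvector of S n k for x exactly when x is a root of the cubic, and it is positive for x > 1.
-- By a Perron–Frobenius argument an eigenvalue with a positive eigenvector bounds the moduli of all
-- others, so a root above 1, found by bisection, is μ; any larger root would be an eigenvalue
-- larger than μ.  Only n = 2, where μ = 1 and this vector vanishes, needs another eigenvector.
-- The cubic is (x − 1)(x² − (n − 1)) − 2k, from which the comparisons with square roots are read off.
--
-- Although order on ℝ is undecidable, ≤ and ≈ are stable under double negation, so claims of these
-- two forms are proved by case distinction; only existence of μ and of square roots and the strict
-- inequality are constructive.
module Submission where

open import Defs
import Algebra.Properties.Semiring.Sum as SemiringSum
import Algebra.Solver.Ring as RingSolver
import Algebra.Solver.Ring.AlmostCommutativeRing as ACR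
open import Algebra.Bundles using (CommutativeRing)
open import Data.Bool.Base using (Bool; true; false; if_then_else_)
open import Data.Empty using (⊥-elim)
open import Data.Fin.Base using (Fin; zero; suc; toℕ; fromℕ<)
open import Data.Fin.Properties using (toℕ-fromℕ<; toℕ-injective; toℕ<n; suc-injective)
open import Data.Integer.Base as ℤ using (+_)
import Data.Integer.Properties as ℤ
import Data.Integer.Solver as ℤSolver
open import Data.Maybe.Base as Maybe using (Maybe)
open import Data.Nat.Base as ℕ using (ℕ; _∸_; zero; suc)
import Data.Nat.Properties as ℕ
open import Data.Product.Base using (_×_; _,_; ∃-syntax; proj₁; proj₂)
open import Data.Rational.Base as ℚ using (ℚ; 0ℚ; 1ℚ; ½; ∣_∣; mkℚ)
import Data.Rational.Properties as ℚ
import Data.Rational.Solver as ℚSolver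
open import Data.Rational.Unnormalised.Base as ℚᵘ using (mkℚᵘ)
import Data.Rational.Unnormalised.Properties as ℚᵘ
open import Data.Sum.Base using (_⊎_; inj₁; inj₂)
open import Function.Base using (_∘_)
open import Function.Bundles using (mk⇔)
open import Level using (0ℓ)
open import Relation.Binary.PropositionalEquality
  using (_≡_; _≢_; refl; sym; trans; cong; cong₂; subst; subst₂)
import Relation.Binary.Reasoning.Setoid as SetoidReasoning
open import Relation.Nullary using (¬_; Dec; does; yes; no; contradiction)
open import Relation.Nullary.Decidable
  using (True; toWitness; from-yes; dec-true; dec-false; dec⇒maybe; does-⇔)

module ℚS = ℚSolver.+-*-Solver
module ℤS = ℤSolver.+-*-Solver

-- The order on ℝ

private
  0<-diff : ∀ {p q} → p ℚ.< q → 0ℚ ℚ.< q ℚ.- p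
  0<-diff {p} {q} p<q = subst (ℚ._< q ℚ.- p) (ℚ.+-inverseʳ p) (ℚ.+-monoˡ-< (ℚ.- p) p<q)

  diff-0< : ∀ {p q} → 0ℚ ℚ.< q ℚ.- p → p ℚ.< q
  diff-0< {p} {q} h = subst₂ ℚ._<_ (ℚ.+-identityʳ p) (cancel-mid q p) (ℚ.+-monoʳ-< p h)

  -- A strict inequality over ℚ follows once the gap of the goal is written as the sum of the gaps
  -- of the hypotheses; that identity is left to the ring solver. `lin₂` and `lin₃` do the same with
  -- more hypotheses.
  lin₁ : ∀ {a b c d} → c ℚ.< d → b ℚ.- a ≡ d ℚ.- c → a ℚ.< b
  lin₁ c<d eq = diff-0< (subst (0ℚ ℚ.<_) (sym eq) (0<-diff c<d))

  0<p+q : ∀ {p q} → 0ℚ ℚ.< p → 0ℚ ℚ.< q → 0ℚ ℚ.< p ℚ.+ q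
  0<p+q {p} {q} 0<p 0<q = subst (ℚ._< p ℚ.+ q) (ℚ.+-identityʳ 0ℚ) (ℚ.+-mono-< 0<p 0<q)

  lin₂ : ∀ {a b c d e f} → c ℚ.< d → e ℚ.< f →
         b ℚ.- a ≡ (d ℚ.- c) ℚ.+ (f ℚ.- e) → a ℚ.< b
  lin₂ c<d e<f eq = diff-0< (subst (0ℚ ℚ.<_) (sym eq) (0<p+q (0<-diff c<d) (0<-diff e<f)))

  lin₃ : ∀ {a b c d e f g h} → c ℚ.< d → e ℚ.< f → g ℚ.< h →
         b ℚ.- a ≡ ((d ℚ.- c) ℚ.+ (f ℚ.- e)) ℚ.+ (h ℚ.- g) → a ℚ.< b
  lin₃ c<d e<f g<h eq = diff-0< (subst (0ℚ ℚ.<_) (sym eq)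
    (0<p+q (0<p+q (0<-diff c<d) (0<-diff e<f)) (0<-diff g<h)))

  ∣-∣<-upper : ∀ {p ε} → ∣ p ∣ ℚ.< ε → p ℚ.< ε
  ∣-∣<-upper {p} h = ℚ.≤-<-trans (p≤∣p∣ p) h
    where
    p≤∣p∣ : ∀ p → p ℚ.≤ ∣ p ∣
    p≤∣p∣ p with ℚ.≤-total 0ℚ p
    ... | inj₁ 0≤p = ℚ.≤-reflexive (sym (ℚ.0≤p⇒∣p∣≡p 0≤p))
    ... | inj₂ p≤0 = ℚ.≤-trans p≤0 (ℚ.0≤∣p∣ p)

  ∣-∣<-intro : ∀ {p ε} → p ℚ.< ε → ℚ.- p ℚ.< ε → ∣ p ∣ ℚ.< ε
  ∣-∣<-intro {p} {ε} h g with ℚ.∣p∣≡p∨∣p∣≡-p p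
  ... | inj₁ eq = subst (ℚ._< ε) (sym eq) h
  ... | inj₂ eq = subst (ℚ._< ε) (sym eq) g

  ev-map : ∀ {P Q : ℕ → Set} → (∀ n → P n → Q n) → Eventually P → Eventually Q
  ev-map f (N , h) = N , λ n N≤n → f n (h n N≤n)

  ev-map₂ : ∀ {P Q R : ℕ → Set} → (∀ n → P n → Q n → R n) →
            Eventually P → Eventually Q → Eventually R
  ev-map₂ f (M , g) (N , h) = M ℕ.⊔ N , λ n M⊔N≤n →
    f n (g n (ℕ.m⊔n≤o⇒m≤o M N M⊔N≤n)) (h n (ℕ.m⊔n≤o⇒n≤o M N M⊔N≤n))

-- The order relations of Defs are functions into Set, from whose values the
-- compared reals cannot be inferred; these records make them inferable.

infix 4 _≃_ _≲_ _≺_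

record _≃_ (x y : ℝ) : Set where
  constructor wrap≈
  field unwrap≈ : x ≈ y

record _≲_ (x y : ℝ) : Set where
  constructor wrap≤
  field unwrap≤ : x ≤ y

record _≺_ (x y : ℝ) : Set where
  constructor wrap<
  field unwrap< : x < y

open _≃_ public
open _≲_ public
open _≺_ public

abstract

  ≃-pointwise : ∀ {x y} → (∀ n → seq x n ≡ seq y n) → x ≃ y
  ≃-pointwise {x} {y} h = wrap≈ λ ε 0<ε → 0 , λ n _ →
    subst (ℚ._< ε) (sym (cong ∣_∣ (trans (cong (ℚ._- seq y n) (h n)) (ℚ.+-inverseʳ (seq y n))))) 0<ε

  ≲-pointwise : ∀ {x y} → (∀ n → seq x n ℚ.≤ seq y n) → x ≲ y
  ≲-pointwise {x} {y} h = wrap≤ λ ε 0<ε → 0 , λ n _ →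
    ℚ.≤-<-trans (h n) (lin₁ 0<ε
      (ℚS.solve 2 (λ y ε → (y :+ ε) :- y := ε :- con 0ℚ) refl (seq y n) ε))
    where open ℚS

  ≃⇒≲ : ∀ {x y} → x ≃ y → x ≲ y
  ≃⇒≲ {x} {y} (wrap≈ h) = wrap≤ λ ε 0<ε → ev-map (λ n d<ε → lin₁ (∣-∣<-upper d<ε)
      (ℚS.solve 3 (λ x y ε → (y :+ ε) :- x := ε :- (x :- y)) refl (seq x n) (seq y n) ε)) (h ε 0<ε)
    where open ℚS

  ≃-sym : ∀ {x y} → x ≃ y → y ≃ x
  ≃-sym {x} {y} (wrap≈ h) = wrap≈ λ ε 0<ε → ev-map (λ n d<ε → subst (ℚ._< ε)
      (trans (sym (ℚ.∣-p∣≡∣p∣ (seq x n ℚ.- seq y n)))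
        (cong ∣_∣ (solve 2 (λ x y → :- (x :- y) := y :- x) refl (seq x n) (seq y n)))) d<ε) (h ε 0<ε)
    where open ℚS

  ≲-antisym : ∀ {x y} → x ≲ y → y ≲ x → x ≃ y
  ≲-antisym {x} {y} (wrap≤ h) (wrap≤ g) = wrap≈ λ ε 0<ε → ev-map₂ (λ n p q → ∣-∣<-intro
      (lin₁ p (solve 3 (λ x y ε → ε :- (x :- y) := (y :+ ε) :- x) refl (seq x n) (seq y n) ε))
      (lin₁ q (solve 3 (λ x y ε → ε :- (:- (x :- y)) := (x :+ ε) :- y) refl (seq x n) (seq y n) ε)))
      (h ε 0<ε) (g ε 0<ε)
    where open ℚS

  ≲-trans : ∀ {x y z} → x ≲ y → y ≲ z → x ≲ z
  ≲-trans {x} {y} {z} (wrap≤ h) (wrap≤ g) = wrap≤ λ ε 0<ε → ev-map₂ (λ n p q → lin₂ p q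
      (solve 4 (λ x y z ε → (z :+ ε) :- x :=
         ((y :+ con ½ :* ε) :- x) :+ ((z :+ con ½ :* ε) :- y)) refl (seq x n) (seq y n) (seq z n) ε))
      (h (½ ℚ.* ε) (half-pos 0<ε)) (g (½ ℚ.* ε) (half-pos 0<ε))
    where open ℚS

  ≺⇒≲ : ∀ {x y} → x ≺ y → x ≲ y
  ≺⇒≲ {x} {y} (wrap< (δ , 0<δ , h)) = wrap≤ λ ε 0<ε → ev-map (λ n p → lin₃ 0<δ p 0<ε
      (solve 4 (λ x y δ ε → (y :+ ε) :- x :=
         ((δ :- con 0ℚ) :+ (y :- (x :+ δ))) :+ (ε :- con 0ℚ)) refl (seq x n) (seq y n) δ ε)) h
    where open ℚS

  ≺-≲-trans : ∀ {x y z} → x ≺ y → y ≲ z → x ≺ z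
  ≺-≲-trans {x} {y} {z} (wrap< (δ , 0<δ , h)) (wrap≤ g) =
    wrap< (½ ℚ.* δ , half-pos 0<δ , ev-map₂ (λ n p q → lin₂ p q
      (solve 4 (λ x y z δ → z :- (x :+ con ½ :* δ) :=
         (y :- (x :+ δ)) :+ ((z :+ con ½ :* δ) :- y)) refl (seq x n) (seq y n) (seq z n) δ))
      h (g (½ ℚ.* δ) (half-pos 0<δ)))
    where open ℚS

  ≲-≺-trans : ∀ {x y z} → x ≲ y → y ≺ z → x ≺ z
  ≲-≺-trans {x} {y} {z} (wrap≤ g) (wrap< (δ , 0<δ , h)) =
    wrap< (½ ℚ.* δ , half-pos 0<δ , ev-map₂ (λ n p q → lin₂ p q
      (solve 4 (λ x y z δ → z :- (x :+ con ½ :* δ) :=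
         (z :- (y :+ δ)) :+ ((y :+ con ½ :* δ) :- x)) refl (seq x n) (seq y n) (seq z n) δ))
      h (g (½ ℚ.* δ) (half-pos 0<δ)))
    where open ℚS

  ≺-irrefl : ∀ {x} → ¬ x ≺ x
  ≺-irrefl {x} (wrap< (δ , 0<δ , N , h)) = ℚ.<-asym 0<δ (lin₁ (h N ℕ.≤-refl)
      (solve 2 (λ x δ → con 0ℚ :- δ := x :- (x :+ δ)) refl (seq x N) δ))
    where open ℚS

  -- For z = x − y and N beyond which z varies by less than η = ε/4, comparing z at N with ε/2
  -- decides between z < ε from N on and z > η from N on; the latter would give y < x.
  ⊀⇒≲ : ∀ {x y} → ¬ y ≺ x → x ≲ y
  ⊀⇒≲ {x} {y} y⊀x = wrap≤ λ ε 0<ε →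
    let N , c = cauchy (x - y) (½ ℚ.* (½ ℚ.* ε)) (half-pos (half-pos 0<ε))
    in decide ε N (half-pos (half-pos 0<ε)) c
    where
    open ℚS
    decide : ∀ ε N → let η = ½ ℚ.* (½ ℚ.* ε) in 0ℚ ℚ.< η →
      (∀ m n → N ℕ.≤ m → N ℕ.≤ n → ∣ seq (x - y) m ℚ.- seq (x - y) n ∣ ℚ.< η) →
      Eventually (λ n → seq x n ℚ.< seq y n ℚ.+ ε)
    decide ε N 0<η c with seq (x - y) N ℚ.<? ½ ℚ.* ε
    ... | yes zN<½ε = N , λ n N≤n → lin₃ 0<η (∣-∣<-upper (c n N N≤n ℕ.≤-refl)) zN<½ε
      (solve 4 (λ x y zN ε → (y :+ ε) :- x :=
          (((con ½ :* (con ½ :* ε)) :- con 0ℚ) :+ (con ½ :* (con ½ :* ε) :- ((x :- y) :- zN)))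
            :+ (con ½ :* ε :- zN)) refl (seq x n) (seq y n) (seq (x - y) N) ε)
    ... | no zN≮½ε = ⊥-elim (y⊀x (wrap< (η , 0<η , N , λ n N≤n →
          diff-0< (ℚ.<-≤-trans (0<-diff (∣-∣<-upper (c N n ℕ.≤-refl N≤n))) (gap n)))))
      where
      η zN : ℚ
      η = ½ ℚ.* (½ ℚ.* ε)
      zN = seq (x - y) N
      gap : ∀ n → η ℚ.- (zN ℚ.- seq (x - y) n) ℚ.≤ seq x n ℚ.- (seq y n ℚ.+ η)
      gap n = subst₂ ℚ._≤_
        (solve 3 (λ a b c → (a :- (b :- c)) :+ (a :+ a :- (a :+ a)) := a :- (b :- c)) refl η zN (seq (x - y) n))
        (solve 4 (λ x y zN ε →
            (con ½ :* (con ½ :* ε) :- (zN :- (x :- y))) :+ (zN :- (con ½ :* (con ½ :* ε) :+ con ½ :* (con ½ :* ε)))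
              := x :- (y :+ con ½ :* (con ½ :* ε))) refl (seq x n) (seq y n) zN ε)
        (ℚ.+-monoʳ-≤ (η ℚ.- (zN ℚ.- seq (x - y) n)) (ℚ.+-monoˡ-≤ (ℚ.- (η ℚ.+ η))
          (subst (ℚ._≤ zN) (sym (half-sum (½ ℚ.* ε))) (ℚ.≮⇒≥ zN≮½ε))))

  +-monoˡ-≲ : ∀ {x y} z → x ≲ y → x + z ≲ y + z
  +-monoˡ-≲ {x} {y} z (wrap≤ h) = wrap≤ λ ε 0<ε → ev-map (λ n p → lin₁ p
      (solve 4 (λ x y z ε → ((y :+ z) :+ ε) :- (x :+ z) := (y :+ ε) :- x)
         refl (seq x n) (seq y n) (seq z n) ε)) (h ε 0<ε)
    where open ℚS

  +-monoˡ-≺ : ∀ {x y} z → x ≺ y → x + z ≺ y + z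
  +-monoˡ-≺ {x} {y} z (wrap< (δ , 0<δ , h)) = wrap< (δ , 0<δ , ev-map (λ n p → lin₁ p
      (solve 4 (λ x y z ε → (y :+ z) :- ((x :+ z) :+ ε) := y :- (x :+ ε))
         refl (seq x n) (seq y n) (seq z n) δ)) h)
    where open ℚS

  *-pos : ∀ {x y} → 0ℝ ≺ x → 0ℝ ≺ y → 0ℝ ≺ x * y
  *-pos {x} {y} (wrap< (δ , 0<δ , h)) (wrap< (ε , 0<ε , g)) =
    wrap< (δ ℚ.* ε , 0<δε , ev-map₂ step h g)
    where
    instance
      δ-pos : ℚ.Positive δ
      δ-pos = ℚ.positive 0<δ
      ε-pos : ℚ.Positive ε
      ε-pos = ℚ.positive 0<ε
    0<δε : 0ℚ ℚ.< δ ℚ.* ε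
    0<δε = ℚ.positive⁻¹ (δ ℚ.* ε) {{ℚ.pos*pos⇒pos δ ε}}
    step : ∀ n → 0ℚ ℚ.+ δ ℚ.< seq x n → 0ℚ ℚ.+ ε ℚ.< seq y n →
           0ℚ ℚ.+ δ ℚ.* ε ℚ.< seq x n ℚ.* seq y n
    step n p q = begin-strict
      0ℚ ℚ.+ δ ℚ.* ε     ≡⟨ ℚ.+-identityˡ _ ⟩
      δ ℚ.* ε            <⟨ ℚ.*-monoʳ-<-pos δ q′ ⟩
      δ ℚ.* seq y n      <⟨ ℚ.*-monoˡ-<-pos (seq y n) {{ℚ.positive (ℚ.<-trans 0<ε q′)}} p′ ⟩
      seq x n ℚ.* seq y n ∎
      where
      open ℚ.≤-Reasoning
      p′ : δ ℚ.< seq x n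
      p′ = subst (ℚ._< seq x n) (ℚ.+-identityˡ δ) p
      q′ : ε ℚ.< seq y n
      q′ = subst (ℚ._< seq y n) (ℚ.+-identityˡ ε) q

  -- A Cauchy sequence is eventually bounded, and a bounded multiple of a null sequence is null.
  *-congˡ′ : ∀ {x y} z → x ≃ y → z * x ≃ z * y
  *-congˡ′ {x} {y} z (wrap≈ h) = wrap≈ λ ε 0<ε →
    let B , B>0 , bound = bounded (seq z) (cauchy z)
        η , 0<η , small = scale ε 0<ε B {{B>0}}
    in ev-map₂ (λ n zn≤B d<η → subst (λ t → ∣ t ∣ ℚ.< ε)
         (solve 3 (λ x y z → z :* (x :- y) := z :* x :- z :* y) refl (seq x n) (seq y n) (seq z n))
         (small (seq z n) (seq x n ℚ.- seq y n) zn≤B d<η)) bound (h η 0<η)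
    where open ℚS

  fromℚ-mono-≲ : ∀ {p q} → p ℚ.≤ q → fromℚ p ≲ fromℚ q
  fromℚ-mono-≲ p≤q = ≲-pointwise λ _ → p≤q

  fromℚ-mono-≺ : ∀ {p q} → p ℚ.< q → fromℚ p ≺ fromℚ q
  -- The margin has to fit strictly inside the gap `q - p`, so half of the gap is taken.
  fromℚ-mono-≺ {p} {q} p<q = wrap< (½ ℚ.* (q ℚ.- p) , half-pos (0<-diff p<q) , 0 , λ n _ →
      lin₁ (half-pos (0<-diff p<q)) (solve 2 (λ p q → q :- (p :+ con ½ :* (q :- p)) := con ½ :* (q :- p) :- con 0ℚ) refl p q))
    where open ℚS

-- ℝ as a commutative ring

≃-refl : ∀ {x} → x ≃ x
≃-refl = ≃-pointwise λ _ → refl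

≃-trans : ∀ {x y z} → x ≃ y → y ≃ z → x ≃ z
≃-trans p q = ≲-antisym (≲-trans (≃⇒≲ p) (≃⇒≲ q)) (≲-trans (≃⇒≲ (≃-sym q)) (≃⇒≲ (≃-sym p)))

+-comm : ∀ x y → x + y ≃ y + x
+-comm x y = ≃-pointwise λ n → ℚ.+-comm (seq x n) (seq y n)

*-comm : ∀ x y → x * y ≃ y * x
*-comm x y = ≃-pointwise λ n → ℚ.*-comm (seq x n) (seq y n)

+-monoʳ-≲ : ∀ {x y} z → x ≲ y → z + x ≲ z + y
+-monoʳ-≲ z x≲y = ≲-trans (≃⇒≲ (+-comm z _)) (≲-trans (+-monoˡ-≲ z x≲y) (≃⇒≲ (+-comm _ z)))

+-mono-≲ : ∀ {x y u v} → x ≲ y → u ≲ v → x + u ≲ y + v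
+-mono-≲ {y = y} {u} x≲y u≲v = ≲-trans (+-monoˡ-≲ u x≲y) (+-monoʳ-≲ y u≲v)

ℝ-commutativeRing : CommutativeRing 0ℓ 0ℓ
ℝ-commutativeRing = record
  { Carrier = ℝ ; _≈_ = _≃_ ; _+_ = _+_ ; _*_ = _*_ ; -_ = -_ ; 0# = 0ℝ ; 1# = 1ℝ
  ; isCommutativeRing = record
    { isRing = record
      { +-isAbelianGroup = record
        { isGroup = record
          { isMonoid = record
            { isSemigroup = record
              { isMagma = record
                { isEquivalence = record { refl = ≃-refl ; sym = ≃-sym ; trans = ≃-trans }
                ; ∙-cong = λ p q → ≲-antisym (+-mono-≲ (≃⇒≲ p) (≃⇒≲ q))
                                             (+-mono-≲ (≃⇒≲ (≃-sym p)) (≃⇒≲ (≃-sym q)))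
                }
              ; assoc = λ x y z → ≃-pointwise λ n → ℚ.+-assoc (seq x n) (seq y n) (seq z n)
              }
            ; identity = (λ x → ≃-pointwise λ n → ℚ.+-identityˡ (seq x n))
                       , (λ x → ≃-pointwise λ n → ℚ.+-identityʳ (seq x n))
            }
          ; inverse = (λ x → ≃-pointwise λ n → ℚ.+-inverseˡ (seq x n))
                    , (λ x → ≃-pointwise λ n → ℚ.+-inverseʳ (seq x n))
          ; ⁻¹-cong = λ p → ≲-antisym (neg-antimono-≲ (≃⇒≲ (≃-sym p))) (neg-antimono-≲ (≃⇒≲ p))
          }
        ; comm = +-comm
        }
      ; *-cong = λ {x} {y} {u} {v} p q → ≃-trans (*-congˡ′ x q)
                   (≃-trans (*-comm x v) (≃-trans (*-congˡ′ v p) (*-comm v y)))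
      ; *-assoc = λ x y z → ≃-pointwise λ n → ℚ.*-assoc (seq x n) (seq y n) (seq z n)
      ; *-identity = (λ x → ≃-pointwise λ n → ℚ.*-identityˡ (seq x n))
                   , (λ x → ≃-pointwise λ n → ℚ.*-identityʳ (seq x n))
      ; distrib = (λ x y z → ≃-pointwise λ n → ℚ.*-distribˡ-+ (seq x n) (seq y n) (seq z n))
                , (λ x y z → ≃-pointwise λ n → ℚ.*-distribʳ-+ (seq x n) (seq y n) (seq z n))
      }
    ; *-comm = *-comm
    }
  }
  where
  open ℚSolver.+-*-Solver
  neg-antimono-≲ : ∀ {x y} → x ≲ y → - y ≲ - x
  neg-antimono-≲ {x} {y} x≲y = ≲-trans
    (≃⇒≲ (≃-pointwise λ n → solve 2 (λ x y → :- y := x :+ (:- x :+ :- y)) refl (seq x n) (seq y n)))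
    (≲-trans (+-monoˡ-≲ (- x + - y) x≲y)
    (≃⇒≲ (≃-pointwise λ n → solve 2 (λ x y → y :+ (:- x :+ :- y) := :- x) refl (seq x n) (seq y n))))

module Rℝ = CommutativeRing ℝ-commutativeRing

-- Rational coefficients give the ring solver for ℝ a decidable equality of constants, which ℝ does
-- not have.
fromℚ-morphism : CommutativeRing.rawRing ℚ.+-*-commutativeRing
  ACR.-Raw-AlmostCommutative⟶ ACR.fromCommutativeRing ℝ-commutativeRing
fromℚ-morphism = record
  { ⟦_⟧    = fromℚ
  ; +-homo = λ _ _ → ≃-pointwise λ _ → refl
  ; *-homo = λ _ _ → ≃-pointwise λ _ → refl
  ; -‿homo = λ _ → ≃-pointwise λ _ → refl
  ; 0-homo = ≃-refl
  ; 1-homo = ≃-refl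
  }

fromℚ-≟ : ∀ p q → Maybe (fromℚ p ≃ fromℚ q)
fromℚ-≟ p q = Maybe.map (λ { refl → ≃-refl }) (dec⇒maybe (p ℚ.≟ q))

module ℝSolver = RingSolver (CommutativeRing.rawRing ℚ.+-*-commutativeRing)
  (ACR.fromCommutativeRing ℝ-commutativeRing) fromℚ-morphism fromℚ-≟

open ℝSolver using (solve; _:=_; _:+_; _:*_; _:-_; :-_; con)
open SemiringSum Rℝ.semiring using
  (sum; sum-cong-≋; ∑-distrib-+; ∑-comm; *-distribˡ-sum; *-distribʳ-sum; sum-replicate-zero)
module ≃-Reasoning = SetoidReasoning Rℝ.setoid

-- Order arithmetic and case distinction under double negation

≲-refl : ∀ {x} → x ≲ x
≲-refl = ≃⇒≲ ≃-refl

≺-resp : ∀ {x y u v} → x ≃ y → u ≃ v → x ≺ u → y ≺ v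
≺-resp p q h = ≺-≲-trans (≲-≺-trans (≃⇒≲ (≃-sym p)) h) (≃⇒≲ q)

≲-resp : ∀ {x y u v} → x ≃ y → u ≃ v → x ≲ u → y ≲ v
≲-resp p q h = ≲-trans (≃⇒≲ (≃-sym p)) (≲-trans h (≃⇒≲ q))

≺-trans : ∀ {x y z} → x ≺ y → y ≺ z → x ≺ z
≺-trans p q = ≺-≲-trans p (≺⇒≲ q)

≲⇒⊁ : ∀ {x y} → x ≲ y → ¬ y ≺ x
≲⇒⊁ p q = ≺-irrefl (≲-≺-trans p q)

≺⇒0≺ : ∀ {x y} → x ≺ y → 0ℝ ≺ y - x
≺⇒0≺ {x} {y} h = ≺-resp (Rℝ.-‿inverseʳ x) ≃-refl (+-monoˡ-≺ (- x) h)

0≺⇒≺ : ∀ {x y} → 0ℝ ≺ y - x → x ≺ y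
0≺⇒≺ {x} {y} h = ≺-resp (Rℝ.+-identityˡ x) (solve 2 (λ x y → (y :- x) :+ x := y) ≃-refl x y)
  (+-monoˡ-≺ x h)

≲⇒0≲ : ∀ {x y} → x ≲ y → 0ℝ ≲ y - x
≲⇒0≲ {x} {y} h = ≲-resp (Rℝ.-‿inverseʳ x) ≃-refl (+-monoˡ-≲ (- x) h)

0≲⇒≲ : ∀ {x y} → 0ℝ ≲ y - x → x ≲ y
0≲⇒≲ {x} {y} h = ≲-resp (Rℝ.+-identityˡ x) (solve 2 (λ x y → (y :- x) :+ x := y) ≃-refl x y)
  (+-monoˡ-≲ x h)

+-pos : ∀ {x y} → 0ℝ ≺ x → 0ℝ ≲ y → 0ℝ ≺ x + y
+-pos {x} {y} p q = ≺-≲-trans p (≲-resp (Rℝ.+-identityʳ x) ≃-refl (+-monoʳ-≲ x q))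

+-nonneg : ∀ {x y} → 0ℝ ≲ x → 0ℝ ≲ y → 0ℝ ≲ x + y
+-nonneg {x} {y} p q = ≲-trans p (≲-resp (Rℝ.+-identityʳ x) ≃-refl (+-monoʳ-≲ x q))

-- By `⊀⇒≲` the weak order is the negation of the reversed strict order, and negations are stable.
≲-stable : ∀ {x y} → ¬ ¬ x ≲ y → x ≲ y
≲-stable h = ⊀⇒≲ λ y≺x → h λ x≲y → ≲⇒⊁ x≲y y≺x

≃-stable : ∀ {x y} → ¬ ¬ x ≃ y → x ≃ y
≃-stable h = ≲-antisym (≲-stable λ k → h λ e → k (≃⇒≲ e)) (≲-stable λ k → h λ e → k (≃⇒≲ (≃-sym e)))

-- Comparison of reals in doubly negated form; it may be used wherever the goal is stable or absurd.
≲-or-≻ : ∀ x y → ¬ ¬ (x ≲ y ⊎ y ≺ x)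
≲-or-≻ x y h = h (inj₁ (⊀⇒≲ λ y≺x → h (inj₂ y≺x)))

≲⇒≺-or-≃ : ∀ {x y} → x ≲ y → ¬ ¬ (x ≺ y ⊎ x ≃ y)
≲⇒≺-or-≃ {x} {y} x≲y h = h (inj₂ (≲-antisym x≲y (⊀⇒≲ λ x≺y → h (inj₁ x≺y))))

*-nonneg : ∀ {x y} → 0ℝ ≲ x → 0ℝ ≲ y → 0ℝ ≲ x * y
*-nonneg {x} {y} p q = ≲-stable λ k → ≲⇒≺-or-≃ p λ
  { (inj₂ 0≃x) → k (≃⇒≲ (≃-trans (≃-sym (Rℝ.zeroˡ y)) (Rℝ.*-congʳ 0≃x)))
  ; (inj₁ 0≺x) → ≲⇒≺-or-≃ q λ
    { (inj₂ 0≃y) → k (≃⇒≲ (≃-trans (≃-sym (Rℝ.zeroʳ x)) (Rℝ.*-congˡ 0≃y)))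
    ; (inj₁ 0≺y) → k (≺⇒≲ (*-pos 0≺x 0≺y)) } }

*-monoʳ-≲ : ∀ {x y} z → 0ℝ ≲ z → x ≲ y → z * x ≲ z * y
*-monoʳ-≲ {x} {y} z 0≲z x≲y = 0≲⇒≲ (≲-resp ≃-refl
  (solve 3 (λ x y z → z :* (y :- x) := z :* y :- z :* x) ≃-refl x y z) (*-nonneg 0≲z (≲⇒0≲ x≲y)))

*-monoˡ-≲ : ∀ {x y} z → 0ℝ ≲ z → x ≲ y → x * z ≲ y * z
*-monoˡ-≲ {x} {y} z 0≲z x≲y = ≲-resp (*-comm z x) (*-comm z y) (*-monoʳ-≲ z 0≲z x≲y)

*-monoˡ-≺ : ∀ {x y} z → 0ℝ ≺ z → x ≺ y → x * z ≺ y * z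
*-monoˡ-≺ {x} {y} z 0≺z x≺y = 0≺⇒≺ (≺-resp ≃-refl
  (solve 3 (λ x y z → (y :- x) :* z := y :* z :- x :* z) ≃-refl x y z) (*-pos (≺⇒0≺ x≺y) 0≺z))

*-cancelʳ-≲ : ∀ {x y} z → 0ℝ ≺ z → x * z ≲ y * z → x ≲ y
*-cancelʳ-≲ z 0≺z h = ⊀⇒≲ λ y≺x → ≲⇒⊁ h (*-monoˡ-≺ z 0≺z y≺x)

-- The goal is stable, so `x` may be split by sign. A nonzero `x` of either sign can be cancelled
-- from the product, which forces `y` to vanish.
*-zero-cancelʳ : ∀ {x y} → ¬ y ≃ 0ℝ → x * y ≃ 0ℝ → x ≃ 0ℝ
*-zero-cancelʳ {x} {y} y≄0 xy≃0 = ≃-stable λ x≄0 → ≲-or-≻ 0ℝ x λ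
  { (inj₁ 0≲x) → ≲⇒≺-or-≃ 0≲x λ
    { (inj₁ 0≺x) → pos 0≺x xy≃0 ; (inj₂ 0≃x) → x≄0 (≃-sym 0≃x) }
  -- A negative `x` is replaced by `- x`, whose product with `y` is still zero.
  ; (inj₂ x≺0) → pos (≺-resp ≃-refl (Rℝ.+-identityˡ (- x)) (≺⇒0≺ x≺0))
      (≃-trans (solve 2 (λ x y → :- x :* y := :- (x :* y)) ≃-refl x y)
        (≃-trans (Rℝ.-‿cong xy≃0) (solve 0 (:- con 0ℚ := con 0ℚ) ≃-refl))) }
  where
  pos : ∀ {x} → 0ℝ ≺ x → ¬ x * y ≃ 0ℝ
  pos {x} 0≺x e = y≄0 (≲-antisym
    (*-cancelʳ-≲ x 0≺x (≃⇒≲ (≃-trans (*-comm y x) (≃-trans e (≃-sym (Rℝ.zeroˡ x))))))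
    (*-cancelʳ-≲ x 0≺x (≃⇒≲ (≃-sym (≃-trans (*-comm y x) (≃-trans e (≃-sym (Rℝ.zeroˡ x))))))))

square-nonneg : ∀ x → 0ℝ ≲ x * x
square-nonneg x = ≲-pointwise λ n → nonneg (seq x n)
  where
  nonneg : ∀ p → 0ℚ ℚ.≤ p ℚ.* p
  nonneg p with ℚ.≤-total 0ℚ p
  ... | inj₁ 0≤p = ℚ.nonNegative⁻¹ (p ℚ.* p)
        {{ℚ.nonNeg*nonNeg⇒nonNeg p {{ℚ.nonNegative 0≤p}} p {{ℚ.nonNegative 0≤p}}}}
  ... | inj₂ p≤0 = ℚ.nonNegative⁻¹ (p ℚ.* p)
        {{ℚ.nonPos*nonPos⇒nonPos p {{ℚ.nonPositive p≤0}} p {{ℚ.nonPositive p≤0}}}}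

square-zero : ∀ {x} → x * x ≃ 0ℝ → x ≃ 0ℝ
square-zero e = ≃-stable λ x≄0 → x≄0 (*-zero-cancelʳ x≄0 e)

square-mono-≺ : ∀ {x y} → 0ℝ ≲ x → x ≺ y → x * x ≺ y * y
square-mono-≺ {x} {y} 0≲x x≺y = ≲-≺-trans (*-monoʳ-≲ x 0≲x (≺⇒≲ x≺y))
  (*-monoˡ-≺ y (≲-≺-trans 0≲x x≺y) x≺y)

square-cancel-≲ : ∀ {x y} → 0ℝ ≲ y → x * x ≲ y * y → x ≲ y
square-cancel-≲ 0≲y h = ⊀⇒≲ λ y≺x → ≲⇒⊁ h (square-mono-≺ 0≲y y≺x)

-- Absolute value

infix 9 ∣_∣ʳ
∣_∣ʳ : ℝ → ℝ
seq ∣ x ∣ʳ n = ∣ seq x n ∣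
cauchy ∣ x ∣ʳ ε 0<ε with cauchy x ε 0<ε
... | N , c = N , λ m n N≤m N≤n → ℚ.≤-<-trans (∣∣p∣-∣q∣∣≤∣p-q∣ (seq x m) (seq x n)) (c m n N≤m N≤n)
  where
  ∣p∣-∣q∣≤∣p-q∣ : ∀ p q → ∣ p ∣ ℚ.- ∣ q ∣ ℚ.≤ ∣ p ℚ.- q ∣
  ∣p∣-∣q∣≤∣p-q∣ p q = begin
    ∣ p ∣ ℚ.- ∣ q ∣                        ≡⟨ cong (λ t → ∣ t ∣ ℚ.- ∣ q ∣) (sym (cancel-mid p q)) ⟩
    ∣ q ℚ.+ (p ℚ.- q) ∣ ℚ.- ∣ q ∣           ≤⟨ ℚ.+-monoˡ-≤ (ℚ.- ∣ q ∣) (ℚ.∣p+q∣≤∣p∣+∣q∣ q (p ℚ.- q)) ⟩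
    (∣ q ∣ ℚ.+ ∣ p ℚ.- q ∣) ℚ.- ∣ q ∣       ≡⟨ ℚS.solve 2 (λ a b → (a ℚS.:+ b) ℚS.:- a ℚS.:= b) refl ∣ q ∣ ∣ p ℚ.- q ∣ ⟩
    ∣ p ℚ.- q ∣                            ∎
    where open ℚ.≤-Reasoning
  ∣∣p∣-∣q∣∣≤∣p-q∣ : ∀ p q → ∣ ∣ p ∣ ℚ.- ∣ q ∣ ∣ ℚ.≤ ∣ p ℚ.- q ∣
  ∣∣p∣-∣q∣∣≤∣p-q∣ p q with ℚ.∣p∣≡p∨∣p∣≡-p (∣ p ∣ ℚ.- ∣ q ∣)
  ... | inj₁ e = ℚ.≤-trans (ℚ.≤-reflexive e) (∣p∣-∣q∣≤∣p-q∣ p q)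
  ... | inj₂ e = ℚ.≤-trans (ℚ.≤-reflexive (trans e (flip ∣ p ∣ ∣ q ∣)))
        (ℚ.≤-trans (∣p∣-∣q∣≤∣p-q∣ q p)
          (ℚ.≤-reflexive (trans (sym (ℚ.∣-p∣≡∣p∣ (q ℚ.- p))) (cong ∣_∣ (flip q p)))))
    where
    flip : ∀ a b → ℚ.- (a ℚ.- b) ≡ b ℚ.- a
    flip = ℚS.solve 2 (λ a b → ℚS.:- (a ℚS.:- b) ℚS.:= b ℚS.:- a) refl

abs-nonneg : ∀ x → 0ℝ ≲ ∣ x ∣ʳ
abs-nonneg x = ≲-pointwise λ n → ℚ.0≤∣p∣ (seq x n)

abs-* : ∀ x y → ∣ x * y ∣ʳ ≃ ∣ x ∣ʳ * ∣ y ∣ʳ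
abs-* x y = ≃-pointwise λ n → ℚ.∣p*q∣≡∣p∣*∣q∣ (seq x n) (seq y n)

abs-+ : ∀ x y → ∣ x + y ∣ʳ ≲ ∣ x ∣ʳ + ∣ y ∣ʳ
abs-+ x y = ≲-pointwise λ n → ℚ.∣p+q∣≤∣p∣+∣q∣ (seq x n) (seq y n)

abs-square : ∀ x → ∣ x ∣ʳ * ∣ x ∣ʳ ≃ x * x
abs-square x = ≃-pointwise λ n → square (seq x n)
  where
  square : ∀ p → ∣ p ∣ ℚ.* ∣ p ∣ ≡ p ℚ.* p
  square p with ℚ.∣p∣≡p∨∣p∣≡-p p
  ... | inj₁ e = cong₂ ℚ._*_ e e
  ... | inj₂ e = trans (cong₂ ℚ._*_ e e) (ℚS.solve 1 (λ p → (ℚS.:- p) ℚS.:* (ℚS.:- p) ℚS.:= p ℚS.:* p) refl p)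

-- Absolute values are nonnegative and have the squares of their arguments, so they are compared
-- through squares.
abs-cong : ∀ {x y} → x ≃ y → ∣ x ∣ʳ ≃ ∣ y ∣ʳ
abs-cong {x} {y} e = ≲-antisym (half e) (half (≃-sym e))
  where
  half : ∀ {x y} → x ≃ y → ∣ x ∣ʳ ≲ ∣ y ∣ʳ
  half {x} {y} e = square-cancel-≲ (abs-nonneg y)
    (≃⇒≲ (≃-trans (abs-square x) (≃-trans (Rℝ.*-cong e e) (≃-sym (abs-square y)))))

abs-nonneg-id : ∀ {x} → 0ℝ ≲ x → ∣ x ∣ʳ ≃ x
abs-nonneg-id {x} 0≲x = ≲-antisym
  (square-cancel-≲ 0≲x (≃⇒≲ (abs-square x)))
  (square-cancel-≲ (abs-nonneg x) (≃⇒≲ (≃-sym (abs-square x))))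

abs-zero : ∀ {x} → ∣ x ∣ʳ ≃ 0ℝ → x ≃ 0ℝ
abs-zero {x} e = square-zero (≃-trans (≃-sym (abs-square x))
  (≃-trans (Rℝ.*-congʳ e) (Rℝ.zeroˡ _)))

-- Bisection

ι : ℕ → ℚ
ι n = + n ℚ./ 1

abstract
  private
    toℚᵘ-ι : ∀ n → ℚ.toℚᵘ (ι n) ℚᵘ.≃ mkℚᵘ (+ n) 0
    toℚᵘ-ι n = ℚ.toℚᵘ-fromℚᵘ (mkℚᵘ (+ n) 0)

  -- Normalisation of fractions blocks a direct computation; over unnormalised fractions the
  -- denominators are visibly 1.
  ι-+ : ∀ m n → ι (m ℕ.+ n) ≡ ι m ℚ.+ ι n
  ι-+ m n = ℚ.toℚᵘ-injective (begin
    ℚ.toℚᵘ (ι (m ℕ.+ n))              ≈⟨ toℚᵘ-ι (m ℕ.+ n) ⟩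
    mkℚᵘ (+ (m ℕ.+ n)) 0              ≈⟨ ℚᵘ.*≡* (ℤS.solve 2 (λ m n → (m ℤS.:+ n) ℤS.:* ℤS.con ℤ.1ℤ
        ℤS.:= (m ℤS.:* ℤS.con ℤ.1ℤ ℤS.:+ n ℤS.:* ℤS.con ℤ.1ℤ) ℤS.:* ℤS.con ℤ.1ℤ) refl (+ m) (+ n)) ⟩
    mkℚᵘ (+ m) 0 ℚᵘ.+ mkℚᵘ (+ n) 0    ≈⟨ ℚᵘ.+-cong (toℚᵘ-ι m) (toℚᵘ-ι n) ⟨
    ℚ.toℚᵘ (ι m) ℚᵘ.+ ℚ.toℚᵘ (ι n)    ≈⟨ ℚ.toℚᵘ-homo-+ (ι m) (ι n) ⟨
    ℚ.toℚᵘ (ι m ℚ.+ ι n)              ∎)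
    where
    open ℚᵘ.≃-Reasoning

  ι-mono : ∀ {m n} → m ℕ.≤ n → ι m ℚ.≤ ι n
  ι-mono {m} {n} m≤n = ℚ.toℚᵘ-cancel-≤ (begin
    ℚ.toℚᵘ (ι m)  ≃⟨ toℚᵘ-ι m ⟩
    mkℚᵘ (+ m) 0  ≤⟨ ℚᵘ.*≤* (ℤ.*-monoʳ-≤-nonNeg (+ 1) (ℤ.+≤+ m≤n)) ⟩
    mkℚᵘ (+ n) 0  ≃⟨ toℚᵘ-ι n ⟨
    ℚ.toℚᵘ (ι n)  ∎)
    where open ℚᵘ.≤-Reasoning

  -- The denominator is at least 1, so dividing by it does not increase the absolute value of the
  -- numerator.
  ≤-ι : ∀ p → p ℚ.≤ ι ℤ.∣ ℚ.↥ p ∣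
  ≤-ι p@(mkℚ n d-1 _) = ℚ.toℚᵘ-cancel-≤ (begin
    mkℚᵘ n d-1             ≤⟨ ℚᵘ.*≤* (bound n) ⟩
    mkℚᵘ (+ ℤ.∣ n ∣) 0      ≃⟨ toℚᵘ-ι ℤ.∣ n ∣ ⟨
    ℚ.toℚᵘ (ι ℤ.∣ n ∣)      ∎)
    where
    open ℚᵘ.≤-Reasoning
    bound : ∀ n → n ℤ.* + 1 ℤ.≤ + ℤ.∣ n ∣ ℤ.* + suc d-1
    bound (+ n) = subst₂ ℤ._≤_ (ℤ.pos-* n 1) (ℤ.pos-* n (suc d-1)) (ℤ.+≤+ (ℕ.*-monoʳ-≤ n (ℕ.s≤s ℕ.z≤n)))
    bound (ℤ.-[1+ n ]) = ℤ.-≤+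

  archimedean : ∀ c {ε} → 0ℚ ℚ.< ε → ∃[ n ] c ℚ.≤ ι n ℚ.* ε
  archimedean c {ε} 0<ε = ℤ.∣ ℚ.↥ d ∣ , (begin
    c                          ≡⟨ sym (ℚ.*-identityʳ c) ⟩
    c ℚ.* 1ℚ                   ≡⟨ cong (c ℚ.*_) (sym (ℚ.*-inverseˡ ε)) ⟩
    c ℚ.* (ℚ.1/ ε ℚ.* ε)       ≡⟨ sym (ℚ.*-assoc c (ℚ.1/ ε) ε) ⟩
    d ℚ.* ε                    ≤⟨ ℚ.*-monoʳ-≤-nonNeg ε {{ℚ.nonNegative (ℚ.<⇒≤ 0<ε)}} (≤-ι d) ⟩
    ι ℤ.∣ ℚ.↥ d ∣ ℚ.* ε        ∎)
    where
    open ℚ.≤-Reasoning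
    instance
      ε≢0 : ℚ.NonZero ε
      ε≢0 = ℚ.pos⇒nonZero ε {{ℚ.positive 0<ε}}
    d : ℚ
    d = c ℚ.* ℚ.1/ ε

fromℕ-+ : ∀ m n → fromℕ (m ℕ.+ n) ≃ fromℕ m + fromℕ n
fromℕ-+ m n = ≃-pointwise λ _ → ι-+ m n

module Bisection
  (f : ℚ → ℚ) (lo hi : ℚ) (lo≤hi : lo ℚ.≤ hi) (flo≤0 : f lo ℚ.≤ 0ℚ) (0≤fhi : 0ℚ ℚ.≤ f hi)
  where

  record Bracket : Set where
    field
      left right   : ℚ
      left≤right   : left ℚ.≤ right
      f-left≤0     : f left ℚ.≤ 0ℚ
      0≤f-right    : 0ℚ ℚ.≤ f right

  open Bracket

  midpoint : Bracket → ℚ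
  midpoint I = ½ ℚ.* (left I ℚ.+ right I)

  abstract
    left≤midpoint : ∀ I → left I ℚ.≤ midpoint I
    left≤midpoint I = subst (ℚ._≤ midpoint I)
      (ℚS.solve 1 (λ a → ℚS.con ½ ℚS.:* (a ℚS.:+ a) ℚS.:= a) refl (left I))
      (ℚ.*-monoˡ-≤-nonNeg ½ (ℚ.+-monoʳ-≤ (left I) (left≤right I)))

    midpoint≤right : ∀ I → midpoint I ℚ.≤ right I
    midpoint≤right I = subst (midpoint I ℚ.≤_)
      (ℚS.solve 1 (λ a → ℚS.con ½ ℚS.:* (a ℚS.:+ a) ℚS.:= a) refl (right I))
      (ℚ.*-monoˡ-≤-nonNeg ½ (ℚ.+-monoˡ-≤ (right I) (left≤right I)))

  width : Bracket → ℚ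
  width I = right I ℚ.- left I

  halve : (I : Bracket) → ∃[ J ]
    (left I ℚ.≤ left J × right J ℚ.≤ right I × width J ≡ ½ ℚ.* width I)
  -- The sign at the midpoint can be decided because `f` takes rational values.
  halve I with f (midpoint I) ℚ.≤? 0ℚ
  ... | yes fm≤0 = record I { left = midpoint I ; left≤right = midpoint≤right I ; f-left≤0 = fm≤0 }
    , left≤midpoint I , ℚ.≤-refl
    , ℚS.solve 2 (λ a b → b ℚS.:- ℚS.con ½ ℚS.:* (a ℚS.:+ b) ℚS.:= ℚS.con ½ ℚS.:* (b ℚS.:- a)) refl (left I) (right I)
  ... | no  fm≰0 = record I { right = midpoint I ; left≤right = left≤midpoint I
                            ; 0≤f-right = ℚ.<⇒≤ (ℚ.≰⇒> fm≰0) }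
    , ℚ.≤-refl , midpoint≤right I
    , ℚS.solve 2 (λ a b → ℚS.con ½ ℚS.:* (a ℚS.:+ b) ℚS.:- a ℚS.:= ℚS.con ½ ℚS.:* (b ℚS.:- a)) refl (left I) (right I)

  bracket : ℕ → Bracket
  bracket zero    = record { left = lo ; right = hi ; left≤right = lo≤hi
                           ; f-left≤0 = flo≤0 ; 0≤f-right = 0≤fhi }
  bracket (suc n) = proj₁ (halve (bracket n))

  left-mono : ∀ {m n} → m ℕ.≤′ n → left (bracket m) ℚ.≤ left (bracket n)
  left-mono ℕ.≤′-refl     = ℚ.≤-refl
  left-mono (ℕ.≤′-step {n} m≤n) = ℚ.≤-trans (left-mono m≤n) (proj₁ (proj₂ (halve (bracket n))))

  right-mono : ∀ {m n} → m ℕ.≤′ n → right (bracket n) ℚ.≤ right (bracket m)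
  right-mono ℕ.≤′-refl     = ℚ.≤-refl
  right-mono (ℕ.≤′-step {n} m≤n) = ℚ.≤-trans (proj₁ (proj₂ (proj₂ (halve (bracket n))))) (right-mono m≤n)

  width-nonneg : ∀ I → 0ℚ ℚ.≤ width I
  width-nonneg I = subst (ℚ._≤ width I) (ℚ.+-inverseʳ (left I)) (ℚ.+-monoˡ-≤ (ℚ.- left I) (left≤right I))

  abstract
    -- The widths decay geometrically, but the rate `(hi - lo) / (n + 1)` suffices and avoids powers
    -- of two; the induction uses n + 2 ≤ 2 (n + 1).
    ι*width≤ : ∀ n → ι (suc n) ℚ.* width (bracket n) ℚ.≤ hi ℚ.- lo
    ι*width≤ zero    = ℚ.≤-reflexive (ℚ.*-identityˡ _)
    ι*width≤ (suc n) = begin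
      ι (suc (suc n)) ℚ.* width (bracket (suc n))
        ≡⟨ cong (ι (suc (suc n)) ℚ.*_) (proj₂ (proj₂ (proj₂ (halve (bracket n))))) ⟩
      ι (suc (suc n)) ℚ.* (½ ℚ.* w)
        ≤⟨ ℚ.*-monoʳ-≤-nonNeg (½ ℚ.* w) {{ℚ.nonNegative ½w≥0}} (ι-mono n+2≤) ⟩
      ι (suc n ℕ.+ suc n) ℚ.* (½ ℚ.* w)
        ≡⟨ cong (ℚ._* (½ ℚ.* w)) (ι-+ (suc n) (suc n)) ⟩
      (ι (suc n) ℚ.+ ι (suc n)) ℚ.* (½ ℚ.* w)
        ≡⟨ ℚS.solve 2 (λ i w → (i ℚS.:+ i) ℚS.:* (ℚS.con ½ ℚS.:* w) ℚS.:= i ℚS.:* w) refl (ι (suc n)) w ⟩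
      ι (suc n) ℚ.* w
        ≤⟨ ι*width≤ n ⟩
      hi ℚ.- lo ∎
      where
      open ℚ.≤-Reasoning
      w : ℚ
      w = width (bracket n)
      ½w≥0 : 0ℚ ℚ.≤ ½ ℚ.* w
      ½w≥0 = subst (ℚ._≤ ½ ℚ.* w) (ℚ.*-zeroʳ ½) (ℚ.*-monoˡ-≤-nonNeg ½ (width-nonneg (bracket n)))
      n+2≤ : suc (suc n) ℕ.≤ suc n ℕ.+ suc n
      n+2≤ = ℕ.s≤s (ℕ.m≤n+m (suc n) n)

    width-null : ∀ ε → 0ℚ ℚ.< ε → ∃[ N ] width (bracket N) ℚ.< ε
    width-null ε 0<ε with archimedean (hi ℚ.- lo) 0<ε
    -- If the width at `N` were at least `ε`, then (N + 1) ε ≤ `hi - lo` ≤ N ε, a contradiction.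
    ... | N , C≤Nε = N , ℚ.≰⇒> λ ε≤w → ℚ.<-irrefl refl (begin-strict
        ι N ℚ.* ε                        <⟨ ℚ.*-monoˡ-<-pos ε {{ℚ.positive 0<ε}} ιN< ⟩
        ι (suc N) ℚ.* ε                  ≤⟨ ℚ.*-monoˡ-≤-nonNeg (ι (suc N)) {{ℚ.nonNegative (ι-mono {0} {suc N} ℕ.z≤n)}} ε≤w ⟩
        ι (suc N) ℚ.* width (bracket N)  ≤⟨ ι*width≤ N ⟩
        hi ℚ.- lo                        ≤⟨ C≤Nε ⟩
        ι N ℚ.* ε                        ∎)
      where
      open ℚ.≤-Reasoning
      ιN< : ι N ℚ.< ι (suc N)
      ιN< = subst₂ ℚ._<_ (ℚ.+-identityˡ (ι N)) (sym (ι-+ 1 N)) (ℚ.+-monoˡ-< (ι N) (ℚ.positive⁻¹ 1ℚ))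

    within : ∀ N {p q} → left (bracket N) ℚ.≤ p → p ℚ.≤ right (bracket N) →
             left (bracket N) ℚ.≤ q → q ℚ.≤ right (bracket N) → ∣ p ℚ.- q ∣ ℚ.≤ width (bracket N)
    within N {p} {q} l≤p p≤r l≤q q≤r with ℚ.∣p∣≡p∨∣p∣≡-p (p ℚ.- q)
    ... | inj₁ e = ℚ.≤-trans (ℚ.≤-reflexive e) (ℚ.+-mono-≤ p≤r (ℚ.neg-antimono-≤ l≤q))
    ... | inj₂ e = ℚ.≤-trans (ℚ.≤-reflexive (trans e
            (ℚS.solve 2 (λ p q → ℚS.:- (p ℚS.:- q) ℚS.:= q ℚS.:- p) refl p q)))
            (ℚ.+-mono-≤ q≤r (ℚ.neg-antimono-≤ l≤p))

  module _ (pick : Bracket → ℚ) (l≤ : ∀ I → left I ℚ.≤ pick I) (≤r : ∀ I → pick I ℚ.≤ right I) where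

    l≤pick : ∀ {N n} → N ℕ.≤ n → left (bracket N) ℚ.≤ pick (bracket n)
    l≤pick N≤n = ℚ.≤-trans (left-mono (ℕ.≤⇒≤′ N≤n)) (l≤ _)

    pick≤r : ∀ {N n} → N ℕ.≤ n → pick (bracket n) ℚ.≤ right (bracket N)
    pick≤r N≤n = ℚ.≤-trans (≤r _) (right-mono (ℕ.≤⇒≤′ N≤n))

    limit : ℝ
    seq    limit n = pick (bracket n)
    cauchy limit ε 0<ε with width-null ε 0<ε
    ... | N , w<ε = N , λ m n N≤m N≤n → ℚ.≤-<-trans
      (within N (l≤pick N≤m) (pick≤r N≤m) (l≤pick N≤n) (pick≤r N≤n)) w<ε

  lower upper : ℝ
  lower = limit left (λ _ → ℚ.≤-refl) left≤right
  upper = limit right left≤right (λ _ → ℚ.≤-refl)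

  lower≃upper : lower ≃ upper
  lower≃upper = wrap≈ λ ε 0<ε → let N , w<ε = width-null ε 0<ε in N , λ n N≤n →
    ℚ.≤-<-trans (within N
      (l≤pick left (λ _ → ℚ.≤-refl) left≤right N≤n) (pick≤r left (λ _ → ℚ.≤-refl) left≤right N≤n)
      (l≤pick right left≤right (λ _ → ℚ.≤-refl) N≤n) (pick≤r right left≤right (λ _ → ℚ.≤-refl) N≤n)) w<ε

  -- The values of `F` are termwise nonpositive along the left ends and nonnegative along the right
  -- ends. Both sequences represent the same real, so `F-cong` brings the two signs together;
  -- `F-seq` says that `F` acts on representatives termwise through `f`, as polynomials do.
  bisection-root : (F : ℝ → ℝ) → (∀ {x y} → x ≃ y → F x ≃ F y) →
    (∀ x n → seq (F x) n ≡ f (seq x n)) → F lower ≃ 0ℝ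
  bisection-root F F-cong F-seq = ≲-antisym
    (≲-pointwise λ n → subst (ℚ._≤ 0ℚ) (sym (F-seq lower n)) (f-left≤0 (bracket n)))
    (≲-trans (≲-pointwise λ n → subst (0ℚ ℚ.≤_) (sym (F-seq upper n)) (0≤f-right (bracket n)))
      (≃⇒≲ (F-cong (≃-sym lower≃upper))))

  lo≲lower : fromℚ lo ≲ lower
  lo≲lower = ≲-pointwise λ n → left-mono (ℕ.≤⇒≤′ (ℕ.z≤n {n}))

  lower≲hi : lower ≲ fromℚ hi
  lower≲hi = ≲-pointwise λ n → ℚ.≤-trans (left≤right (bracket n)) (right-mono (ℕ.≤⇒≤′ (ℕ.z≤n {n})))

-- Intermediate values and square roots

intermediate-value : (F : ℝ → ℝ) (f : ℚ → ℚ) → (∀ {x y} → x ≃ y → F x ≃ F y) →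
  (∀ x n → seq (F x) n ≡ f (seq x n)) →
  ∀ {lo hi} → lo ℚ.≤ hi → f lo ℚ.≤ 0ℚ → 0ℚ ℚ.≤ f hi →
  ∃[ x ] (F x ≃ 0ℝ × fromℚ lo ≲ x × x ≲ fromℚ hi)
intermediate-value F f F-cong F-seq lo≤hi flo≤0 0≤fhi =
  lower , bisection-root F F-cong F-seq , lo≲lower , lower≲hi
  where open Bisection f _ _ lo≤hi flo≤0 0≤fhi

sqrt-between : ∀ c {lo hi} → 0ℚ ℚ.≤ lo → lo ℚ.≤ hi → lo ℚ.* lo ℚ.≤ c → c ℚ.≤ hi ℚ.* hi →
  ∃[ s ] (s * s ≃ fromℚ c × fromℚ lo ≲ s × s ≲ fromℚ hi)
sqrt-between c {lo} {hi} 0≤lo lo≤hi lo²≤c c≤hi² =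
  let s , s²-c≃0 , lo≲s , s≲hi = intermediate-value
        (λ x → x * x - fromℚ c) (λ q → q ℚ.* q ℚ.- c)
        (λ e → Rℝ.+-congʳ (Rℝ.*-cong e e)) (λ _ _ → refl) lo≤hi
        (subst (lo ℚ.* lo ℚ.- c ℚ.≤_) (ℚ.+-inverseʳ c) (ℚ.+-monoˡ-≤ (ℚ.- c) lo²≤c))
        (subst (ℚ._≤ hi ℚ.* hi ℚ.- c) (ℚ.+-inverseʳ c) (ℚ.+-monoˡ-≤ (ℚ.- c) c≤hi²))
  in s , ≃-trans (solve 2 (λ s c → s :* s := (s :* s :- c) :+ c) ≃-refl s (fromℚ c))
           (≃-trans (Rℝ.+-congʳ s²-c≃0) (Rℝ.+-identityˡ (fromℚ c)))
       , lo≲s , s≲hi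

-- Graphs with a positive eigenvector

sum-mono-≲ : ∀ {n} {f g : Fin n → ℝ} → (∀ i → f i ≲ g i) → sum f ≲ sum g
sum-mono-≲ {ℕ.zero}  h = ≲-refl
sum-mono-≲ {ℕ.suc n} h = +-mono-≲ (h zero) (sum-mono-≲ (h ∘ suc))

sum-nonneg : ∀ {n} {f : Fin n → ℝ} → (∀ i → 0ℝ ≲ f i) → 0ℝ ≲ sum f
sum-nonneg {ℕ.zero}  h = ≲-refl
sum-nonneg {ℕ.suc n} h = +-nonneg (h zero) (sum-nonneg (h ∘ suc))

+-nonneg-zeroˡ : ∀ {x y} → 0ℝ ≲ x → 0ℝ ≲ y → x + y ≃ 0ℝ → x ≃ 0ℝ
+-nonneg-zeroˡ {x} {y} 0≲x 0≲y e = ≲-antisym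
  (≲-resp (Rℝ.+-identityʳ x) e (+-monoʳ-≲ x 0≲y)) 0≲x

+-nonneg-zeroʳ : ∀ {x y} → 0ℝ ≲ x → 0ℝ ≲ y → x + y ≃ 0ℝ → y ≃ 0ℝ
+-nonneg-zeroʳ {x} {y} 0≲x 0≲y e = +-nonneg-zeroˡ 0≲y 0≲x (≃-trans (+-comm y x) e)

sum-nonneg-zero : ∀ {n} {f : Fin n → ℝ} → (∀ i → 0ℝ ≲ f i) → sum f ≃ 0ℝ → ∀ i → f i ≃ 0ℝ
sum-nonneg-zero h e zero    = +-nonneg-zeroˡ (h zero) (sum-nonneg (h ∘ suc)) e
sum-nonneg-zero h e (suc i) =
  sum-nonneg-zero (h ∘ suc) (+-nonneg-zeroʳ (h zero) (sum-nonneg (h ∘ suc)) e) i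

abs-sum : ∀ {n} (f : Fin n → ℝ) → ∣ sum f ∣ʳ ≲ sum (∣_∣ʳ ∘ f)
abs-sum {ℕ.zero}  f = ≃⇒≲ (abs-nonneg-id ≲-refl)
abs-sum {ℕ.suc n} f = ≲-trans (abs-+ (f zero) (sum (f ∘ suc))) (+-monoʳ-≲ _ (abs-sum (f ∘ suc)))

+-absorb⇒zero : ∀ {x y} → x + y ≃ y → x ≃ 0ℝ
+-absorb⇒zero {x} {y} e = begin
  x             ≈⟨ solve 2 (λ x y → x := (x :+ y) :- y) ≃-refl x y ⟩
  (x + y) - y   ≈⟨ Rℝ.+-congʳ e ⟩
  y - y         ≈⟨ Rℝ.-‿inverseʳ y ⟩
  0ℝ            ∎
  where open ≃-Reasoning

-- i maximises f i / w i; the fractions are multiplied out because ℝ has no division here.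
MaxRatio : ∀ {n} (f w : Fin n → ℝ) → Fin n → Set
MaxRatio f w i = ∀ j → f j * w i ≲ f i * w j

-- A maximum over finitely many reals exists in doubly negated form, since each comparison is
-- undecidable. The argument in `Fin n` witnesses that the index set is nonempty.
maxRatio : ∀ {n} (f w : Fin n → ℝ) → (∀ i → 0ℝ ≺ w i) → Fin n → ¬ ¬ (∃[ i ] MaxRatio f w i)
maxRatio {ℕ.suc ℕ.zero}    f w 0≺w _ k = k (zero , λ { zero → ≲-refl })
maxRatio {ℕ.suc (ℕ.suc n)} f w 0≺w _ k =
  maxRatio (f ∘ suc) (w ∘ suc) (0≺w ∘ suc) zero λ { (i , max) →
    ≲-or-≻ (f zero * w (suc i)) (f (suc i) * w zero) λ
    { (inj₁ f₀≲fᵢ) → k (suc i , λ { zero → f₀≲fᵢ ; (suc j) → max j })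
    ; (inj₂ fᵢ≺f₀) → k (zero , λ { zero → ≲-refl ; (suc j) →
        ratio-trans {y = f (suc i)} (0≺w (suc i)) (≺⇒≲ (0≺w zero)) (≺⇒≲ (0≺w (suc j))) (max j) (≺⇒≲ fᵢ≺f₀) }) } }
  where
  -- This is x/u ≤ y/v ≤ z/w with denominators cleared: multiply the first inequality by `w`, the
  -- second by `u`, and cancel `v`.
  ratio-trans : ∀ {x y z u v w} → 0ℝ ≺ v → 0ℝ ≲ w → 0ℝ ≲ u →
    x * v ≲ y * u → y * w ≲ z * v → x * w ≲ z * u
  ratio-trans {x} {y} {z} {u} {v} {w} 0≺v 0≲w 0≲u p q = *-cancelʳ-≲ v 0≺v (≲-trans
    (≲-resp (solve 3 (λ x v w → x :* v :* w := x :* w :* v) ≃-refl x v w)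
            (solve 3 (λ y u w → y :* u :* w := y :* w :* u) ≃-refl y u w) (*-monoˡ-≲ w 0≲w p))
    (≲-resp ≃-refl (solve 3 (λ z v u → z :* v :* u := z :* u :* v) ≃-refl z v u) (*-monoˡ-≲ u 0≲u q)))

re-sum : ∀ {n} (f : Fin n → ℂ) → re (ℂᵣ.sum f) ≡ sum (re ∘ f)
re-sum {ℕ.zero}  f = refl
re-sum {ℕ.suc n} f = cong (λ x → re (f zero) + x) (re-sum (f ∘ suc))

im-sum : ∀ {n} (f : Fin n → ℂ) → im (ℂᵣ.sum f) ≡ sum (im ∘ f)
im-sum {ℕ.zero}  f = refl
im-sum {ℕ.suc n} f = cong (λ x → im (f zero) + x) (im-sum (f ∘ suc))

modulus-unique : ∀ {z r s} → IsModulus z r → IsModulus z s → r ≃ s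
modulus-unique {z} {r} {s} (0≤r , r²) (0≤s , s²) = ≲-antisym
  (square-cancel-≲ (wrap≤ 0≤s) (≃⇒≲ (≃-trans r²′ (≃-sym s²′))))
  (square-cancel-≲ (wrap≤ 0≤r) (≃⇒≲ (≃-trans s²′ (≃-sym r²′))))
  where
  r²′ : r * r ≃ re z * re z + im z * im z
  r²′ = wrap≈ r²
  s²′ : s * s ≃ re z * re z + im z * im z
  s²′ = wrap≈ s²

𝟙 : Bool → ℝ
𝟙 b = if b then 1ℝ else 0ℝ

𝟙-nonneg : ∀ b → 0ℝ ≲ 𝟙 b
𝟙-nonneg true  = fromℚ-mono-≲ (ℚ.*≤* (ℤ.+≤+ ℕ.z≤n))
𝟙-nonneg false = ≲-refl

-- Eigenvalues of an adjacency matrix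

module Spectrum {n : ℕ} (G : Graph n) where

  A : Fin n → Fin n → ℝ
  A i j = 𝟙 (does (Graph.adj? G i j))

  A-symmetric : ∀ i j → A i j ≡ A j i
  A-symmetric i j = cong 𝟙 (does-⇔ (mk⇔ (Graph.symm G) (Graph.symm G)) (Graph.adj? G i j) (Graph.adj? G j i))

  A-nonneg : ∀ i j → 0ℝ ≲ A i j
  A-nonneg i j = 𝟙-nonneg (does (Graph.adj? G i j))

  row : (Fin n → ℝ) → Fin n → ℝ
  row u i = sum λ j → A i j * u j

  RealEigenvector : ℝ → (Fin n → ℝ) → Set
  RealEigenvector a u = ∀ i → row u i ≃ a * u i

  -- The matrix entries are real, so the matrix acts separately on real and imaginary parts.
  re-· : ∀ v i → re ((adjacencyMatrix G · v) i) ≃ row (re ∘ v) i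
  re-· v i = ≃-trans (Rℝ.reflexive (re-sum λ j → adjacencyMatrix G i j ℂᵣ.* v j))
    (sum-cong-≋ λ j → entry (does (Graph.adj? G i j)) (v j))
    where
    entry : ∀ b z → re ((if b then ℂᵣ.1# else ℂᵣ.0#) ℂᵣ.* z) ≃ 𝟙 b * re z
    entry true  z = solve 2 (λ x y → con 1ℚ :* x :- con 0ℚ :* y := con 1ℚ :* x) ≃-refl (re z) (im z)
    entry false z = solve 2 (λ x y → con 0ℚ :* x :- con 0ℚ :* y := con 0ℚ :* x) ≃-refl (re z) (im z)

  im-· : ∀ v i → im ((adjacencyMatrix G · v) i) ≃ row (im ∘ v) i
  im-· v i = ≃-trans (Rℝ.reflexive (im-sum λ j → adjacencyMatrix G i j ℂᵣ.* v j))
    (sum-cong-≋ λ j → entry (does (Graph.adj? G i j)) (v j))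
    where
    entry : ∀ b z → im ((if b then ℂᵣ.1# else ℂᵣ.0#) ℂᵣ.* z) ≃ 𝟙 b * im z
    entry true  z = solve 2 (λ x y → con 1ℚ :* y :+ con 0ℚ :* x := con 1ℚ :* y) ≃-refl (re z) (im z)
    entry false z = solve 2 (λ x y → con 0ℚ :* y :+ con 0ℚ :* x := con 0ℚ :* y) ≃-refl (re z) (im z)

  bilinear-symmetric : ∀ p q → sum (λ i → p i * row q i) ≃ sum (λ i → q i * row p i)
  bilinear-symmetric p q = begin
    sum (λ i → p i * row q i)
      ≈⟨ sum-cong-≋ (λ i → *-distribˡ-sum (p i) (λ j → A i j * q j)) ⟩
    sum (λ i → sum λ j → p i * (A i j * q j))
      ≈⟨ ∑-comm (λ i j → p i * (A i j * q j)) ⟩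
    sum (λ j → sum λ i → p i * (A i j * q j))
      ≈⟨ sum-cong-≋ (λ j → sum-cong-≋ λ i → ≃-trans
           (Rℝ.*-congˡ (Rℝ.*-congʳ (Rℝ.reflexive (A-symmetric i j))))
           (solve 3 (λ a p q → p :* (a :* q) := q :* (a :* p)) ≃-refl (A j i) (p i) (q j))) ⟩
    sum (λ j → sum λ i → q j * (A j i * p i))
      ≈⟨ sum-cong-≋ (λ j → *-distribˡ-sum (q j) (λ i → A j i * p i)) ⟨
    sum (λ j → q j * row p j) ∎
    where open ≃-Reasoning

  module _ {z : ℂ} (v : Fin n → ℂ) (eigen : ∀ i → (adjacencyMatrix G · v) i ℂᵣ.≈ z ℂᵣ.* v i) where

    private
      a b : ℝ
      a = re z
      b = im z
      p q : Fin n → ℝ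
      p = re ∘ v
      q = im ∘ v

    row-re : ∀ i → row p i ≃ a * p i - b * q i
    row-re i = ≃-trans (≃-sym (re-· v i)) (wrap≈ (proj₁ (eigen i)))

    row-im : ∀ i → row q i ≃ a * q i + b * p i
    row-im i = ≃-trans (≃-sym (im-· v i)) (wrap≈ (proj₂ (eigen i)))

    norm² : ℝ
    norm² = sum λ i → p i * p i + q i * q i

    -- The usual proof that a real symmetric matrix has real eigenvalues. For `v` = p + iq, the
    -- forms pᵀAq and qᵀAp agree by symmetry, while the eigenvalue equation makes them differ by
    -- `b * norm²`.
    im*norm²≃0 : b * norm² ≃ 0ℝ
    im*norm²≃0 = +-absorb⇒zero (begin
      b * norm² + sum (λ i → q i * row p i)
        ≈⟨ Rℝ.+-congʳ (*-distribˡ-sum b (λ i → p i * p i + q i * q i)) ⟩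
      sum (λ i → b * (p i * p i + q i * q i)) + sum (λ i → q i * row p i)
        ≈⟨ ∑-distrib-+ (λ i → b * (p i * p i + q i * q i)) (λ i → q i * row p i) ⟨
      sum (λ i → b * (p i * p i + q i * q i) + q i * row p i)
        ≈⟨ sum-cong-≋ (λ i → ≃-trans (Rℝ.+-congˡ (Rℝ.*-congˡ (row-re i))) (≃-trans
             (solve 4 (λ a b p q → b :* (p :* p :+ q :* q) :+ q :* (a :* p :- b :* q)
                        := p :* (a :* q :+ b :* p)) ≃-refl a b (p i) (q i))
             (Rℝ.*-congˡ (≃-sym (row-im i))))) ⟩
      sum (λ i → p i * row q i)
        ≈⟨ bilinear-symmetric p q ⟩
      sum (λ i → q i * row p i) ∎)
      where open ≃-Reasoning

    eigenvalue-real : ¬ (∀ i → v i ℂᵣ.≈ ℂᵣ.0#) → b ≃ 0ℝ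
    eigenvalue-real v≄0 = *-zero-cancelʳ (λ norm²≃0 → v≄0 λ i →
        let e = sum-nonneg-zero (λ i → +-nonneg (square-nonneg (p i)) (square-nonneg (q i))) norm²≃0 i
        in unwrap≈ (square-zero (+-nonneg-zeroˡ (square-nonneg (p i)) (square-nonneg (q i)) e))
         , unwrap≈ (square-zero (+-nonneg-zeroʳ (square-nonneg (p i)) (square-nonneg (q i)) e)))
      im*norm²≃0

  -- Maximise |u i| / w i and compare the i-th rows of A u = a u and A w = μ w.
  eigenvalue-bound : ∀ {μ w} → (∀ i → 0ℝ ≺ w i) → RealEigenvector μ w →
    ∀ {a u} → RealEigenvector a u → ¬ ∣ a ∣ʳ ≲ μ → ∀ j → u j ≃ 0ℝ
  eigenvalue-bound {μ} {w} 0≺w Aw {a} {u} Au a≰μ j = ≃-stable λ uⱼ≄0 →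
    maxRatio (∣_∣ʳ ∘ u) w 0≺w j λ { (i , max) →
      ≲⇒≺-or-≃ (*-nonneg (abs-nonneg (u i)) (≺⇒≲ (0≺w i))) λ
      { (inj₁ 0≺t) → a≰μ (*-cancelʳ-≲ (∣ u i ∣ʳ * w i) 0≺t (a*t≲μ*t i max))
      -- If `∣ u i ∣ʳ` vanishes, the maximal ratio is zero, and so is every other ratio.
      ; (inj₂ 0≃t) → uⱼ≄0 (abs-zero (≲-antisym
          (*-cancelʳ-≲ (w i) (0≺w i) (≲-trans (max j) (≃⇒≲ (begin
            ∣ u i ∣ʳ * w j   ≈⟨ Rℝ.*-congʳ (*-zero-cancelʳ (w≄0 i) (≃-sym 0≃t)) ⟩
            0ℝ * w j         ≈⟨ Rℝ.zeroˡ (w j) ⟩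
            0ℝ               ≈⟨ Rℝ.zeroˡ (w i) ⟨
            0ℝ * w i         ∎))))
          (abs-nonneg (u j)))) } }
    where
    open ≃-Reasoning
    w≄0 : ∀ i → ¬ w i ≃ 0ℝ
    w≄0 i e = ≲⇒⊁ (≃⇒≲ e) (0≺w i)
    -- Apply the triangle inequality to row `i` of `u`, then replace each `∣ u j ∣ʳ * w i` by the
    -- larger `∣ u i ∣ʳ * w j`; what results is row `i` of `w` scaled by `∣ u i ∣ʳ`.
    a*t≲μ*t : ∀ i → MaxRatio (∣_∣ʳ ∘ u) w i → ∣ a ∣ʳ * (∣ u i ∣ʳ * w i) ≲ μ * (∣ u i ∣ʳ * w i)
    a*t≲μ*t i max = ≲-resp
      (begin
        ∣ row u i ∣ʳ * w i          ≈⟨ Rℝ.*-congʳ (abs-cong (Au i)) ⟩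
        ∣ a * u i ∣ʳ * w i          ≈⟨ Rℝ.*-congʳ (abs-* a (u i)) ⟩
        (∣ a ∣ʳ * ∣ u i ∣ʳ) * w i   ≈⟨ Rℝ.*-assoc ∣ a ∣ʳ ∣ u i ∣ʳ (w i) ⟩
        ∣ a ∣ʳ * (∣ u i ∣ʳ * w i)   ∎)
      (begin
        sum (λ j → A i j * (∣ u i ∣ʳ * w j))
          ≈⟨ sum-cong-≋ (λ j → solve 3 (λ a u w → a :* (u :* w) := u :* (a :* w)) ≃-refl (A i j) ∣ u i ∣ʳ (w j)) ⟩
        sum (λ j → ∣ u i ∣ʳ * (A i j * w j))
          ≈⟨ *-distribˡ-sum ∣ u i ∣ʳ (λ j → A i j * w j) ⟨
        ∣ u i ∣ʳ * row w i          ≈⟨ Rℝ.*-congˡ (Aw i) ⟩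
        ∣ u i ∣ʳ * (μ * w i)        ≈⟨ solve 3 (λ u μ w → u :* (μ :* w) := μ :* (u :* w)) ≃-refl ∣ u i ∣ʳ μ (w i) ⟩
        μ * (∣ u i ∣ʳ * w i)        ∎)
      (≲-trans (*-monoˡ-≲ (w i) (≺⇒≲ (0≺w i)) (abs-sum (λ j → A i j * u j)))
      (≲-trans (≃⇒≲ (≃-trans (*-distribʳ-sum (w i) (λ j → ∣ A i j * u j ∣ʳ))
        (sum-cong-≋ (λ j → ≃-trans (Rℝ.*-congʳ (≃-trans (abs-* (A i j) (u j)) (Rℝ.*-congʳ (abs-nonneg-id (A-nonneg i j)))))
                                    (Rℝ.*-assoc (A i j) ∣ u j ∣ʳ (w i))))))
        (sum-mono-≲ (λ j → *-monoʳ-≲ (A i j) (A-nonneg i j) (max j)))))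

  realEigenvector⇒eigenvalue : ∀ {a u} → RealEigenvector a u → ¬ (∀ i → u i ≃ 0ℝ) →
    IsEigenvalue (adjacencyMatrix G) (a +i 0ℝ)
  realEigenvector⇒eigenvalue {a} {u} Au u≄0 = v
    , (λ v≈0 → u≄0 λ i → wrap≈ (proj₁ (v≈0 i)))
    , λ i → unwrap≈ (≃-trans (re-· v i) (≃-trans (Au i)
              (solve 2 (λ a u → a :* u := a :* u :- con 0ℚ :* con 0ℚ) ≃-refl a (u i))))
          , unwrap≈ (≃-trans (im-· v i) (≃-trans (sum-zero i)
              (solve 2 (λ a u → con 0ℚ := a :* con 0ℚ :+ con 0ℚ :* u) ≃-refl a (u i))))
    where
    v : Fin n → ℂ
    v i = u i +i 0ℝ
    sum-zero : ∀ i → row (im ∘ v) i ≃ 0ℝ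
    sum-zero i = ≃-trans (≃-sym (*-distribʳ-sum 0ℝ (A i))) (Rℝ.zeroʳ (sum (A i)))

  positiveEigenvector⇒Isμ : ∀ {μ w} → 0ℝ ≲ μ → (∀ i → 0ℝ ≺ w i) → RealEigenvector μ w →
    Fin n → Isμ G μ
  positiveEigenvector⇒Isμ {μ} {w} 0≲μ 0≺w Aw i₀ =
    (μ +i 0ℝ , realEigenvector⇒eigenvalue Aw (λ w≃0 → ≲⇒⊁ (≃⇒≲ (w≃0 i₀)) (0≺w i₀))
      , (unwrap≤ 0≲μ , unwrap≈ (solve 1 (λ a → a :* a := a :* a :+ con 0ℚ :* con 0ℚ) ≃-refl μ)))
    , λ { z (v , v≄0 , eigen) →
      let b≃0 = eigenvalue-real {z} v eigen v≄0 in
      -- Since `im z` vanishes, this is the modulus of `z`.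
      ∣ re z ∣ʳ
      , (unwrap≤ (abs-nonneg (re z)) , unwrap≈ (≃-trans (abs-square (re z)) (≃-trans
           (solve 1 (λ a → a :* a := a :* a :+ con 0ℚ :* con 0ℚ) ≃-refl (re z))
           (Rℝ.+-congˡ (≃-sym (Rℝ.*-cong b≃0 b≃0))))))
      -- Real and imaginary parts of `v` both satisfy the real eigenvalue equation for `re z`. If
      -- the bound failed, both would vanish, against `v≄0`.
      , unwrap≤ (≲-stable λ a≰μ → v≄0 λ i →
          unwrap≈ (eigenvalue-bound 0≺w Aw {re z} {re ∘ v} (λ i → ≃-trans (row-re {z} v eigen i)
            (≃-trans (Rℝ.+-congˡ (Rℝ.-‿cong (Rℝ.*-congʳ b≃0)))
              (solve 2 (λ x y → x :- con 0ℚ :* y := x) ≃-refl (re z * re (v i)) (im (v i))))) a≰μ i)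
        , unwrap≈ (eigenvalue-bound 0≺w Aw {re z} {im ∘ v} (λ i → ≃-trans (row-im {z} v eigen i)
            (≃-trans (Rℝ.+-congˡ (Rℝ.*-congʳ b≃0))
              (solve 2 (λ x y → x :+ con 0ℚ :* y := x) ≃-refl (re z * im (v i)) (re (v i))))) a≰μ i)) }

  -- One radius is attained as the modulus of an eigenvalue, which the other radius bounds.
  Isμ-≲ : ∀ {μ ν} → Isμ G μ → Isμ G ν → μ ≲ ν
  Isμ-≲ {μ} ((z , z-eigen , |z|=μ) , _) (_ , max) with max z z-eigen
  ... | r , |z|=r , r≤ν = ≲-trans (≃⇒≲ (modulus-unique {z} {μ} {r} |z|=μ |z|=r)) (wrap≤ r≤ν)

  Isμ-unique : ∀ {μ ν} → Isμ G μ → Isμ G ν → μ ≃ ν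
  Isμ-unique p q = ≲-antisym (Isμ-≲ p q) (Isμ-≲ q p)

  realEigenvalue≲μ : ∀ {μ} → Isμ G μ → ∀ {a u} → RealEigenvector a u → ¬ (∀ i → u i ≃ 0ℝ) → a ≲ μ
  realEigenvalue≲μ (_ , max) {a} {u} Au u≄0 =
    let r , (0≤r , r²≈) , r≤μ = max (a +i 0ℝ) (realEigenvector⇒eigenvalue {a} {u} Au u≄0)
    in ≲-trans (square-cancel-≲ (wrap≤ 0≤r) (≃⇒≲ (≃-sym (≃-trans (wrap≈ {r * r} {a * a + 0ℝ * 0ℝ} r²≈)
         (solve 1 (λ a → a :* a :+ con 0ℚ :* con 0ℚ := a :* a) ≃-refl a))))) (wrap≤ r≤μ)

-- Row sums of the adjacency matrix of S n k

𝟙-yes : ∀ {P : Set} (P? : Dec P) → P → ∀ x → 𝟙 (does P?) * x ≃ x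
𝟙-yes P? p x rewrite dec-true P? p = Rℝ.*-identityˡ x

𝟙-no : ∀ {P : Set} (P? : Dec P) → ¬ P → ∀ x → 𝟙 (does P?) * x ≃ 0ℝ
𝟙-no P? ¬p x rewrite dec-false P? ¬p = Rℝ.zeroˡ x

sum-zero : ∀ {n} {f : Fin n → ℝ} → (∀ i → f i ≃ 0ℝ) → sum f ≃ 0ℝ
sum-zero {n} h = ≃-trans (sum-cong-≋ h) (sum-replicate-zero n)

sum-single : ∀ {n} {f : Fin n → ℝ} i → (∀ j → j ≢ i → f j ≃ 0ℝ) → sum f ≃ f i
sum-single {f = f} zero    h = ≃-trans (Rℝ.+-congˡ (sum-zero λ j → h (suc j) λ ())) (Rℝ.+-identityʳ (f zero))
sum-single {f = f} (suc i) h = ≃-trans (Rℝ.+-cong (h zero λ ()) (sum-single i λ j j≢i → h (suc j) (j≢i ∘ suc-injective)))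
  (Rℝ.+-identityˡ (f (suc i)))

-- Leaves on chords are numbered before the remaining leaves, so a vector constant on each kind is a
-- step function of the leaf index.
step : ℕ → ℝ → ℝ → ℕ → ℝ
step K d e j = if does (j ℕ.<? K) then d else e

step-< : ∀ {K j} d e → j ℕ.< K → step K d e j ≡ d
step-< {K} {j} d e j<K = cong (if_then d else e) (dec-true (j ℕ.<? K) j<K)

step-≮ : ∀ {K j} d e → ¬ j ℕ.< K → step K d e j ≡ e
step-≮ {K} {j} d e j≮K = cong (if_then d else e) (dec-false (j ℕ.<? K) j≮K)

fromℕ-suc-* : ∀ n x → fromℕ (ℕ.suc n) * x ≃ x + fromℕ n * x
fromℕ-suc-* n x = ≃-trans (Rℝ.*-congʳ (fromℕ-+ 1 n))
  (solve 2 (λ n x → (con 1ℚ :+ n) :* x := x :+ n :* x) ≃-refl (fromℕ n) x)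

sum-step : ∀ {N K} d e → K ℕ.≤ N →
  sum {N} (λ j → step K d e (toℕ j)) ≃ fromℕ K * d + fromℕ (N ∸ K) * e
sum-step {ℕ.zero}  {ℕ.zero}  d e _ =
  solve 2 (λ d e → con 0ℚ := con 0ℚ :* d :+ con 0ℚ :* e) ≃-refl d e
sum-step {ℕ.suc N} {ℕ.zero}  d e _ = ≃-trans (Rℝ.+-congˡ (sum-step {N} {0} d e ℕ.z≤n))
  (≃-trans (solve 4 (λ z d e n → e :+ (z :* d :+ n) := z :* d :+ (e :+ n)) ≃-refl 0ℝ d e (fromℕ N * e))
    (Rℝ.+-congˡ (≃-sym (fromℕ-suc-* N e))))
sum-step {ℕ.suc N} {ℕ.suc K} d e (ℕ.s≤s K≤N) = ≃-trans (Rℝ.+-congˡ (sum-step d e K≤N))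
  (≃-trans (≃-sym (Rℝ.+-assoc d (fromℕ K * d) _)) (Rℝ.+-congʳ (≃-sym (fromℕ-suc-* K d))))

parity : ∀ i → ∃[ a ] (i ≡ 2 ℕ.* a ⊎ i ≡ ℕ.suc (2 ℕ.* a))
parity ℕ.zero    = 0 , inj₁ refl
parity (ℕ.suc i) with parity i
... | a , inj₁ refl = a , inj₂ refl
... | a , inj₂ refl = ℕ.suc a , inj₁ (sym (ℕ.*-suc 2 a))

module AdjacencyRows (N k : ℕ) (2k≤N : 2 ℕ.* k ℕ.≤ N) where

  K : ℕ
  K = 2 ℕ.* k

  open Graph (S (ℕ.suc N) k)
  open Spectrum (S (ℕ.suc N) k) public

  -- 1-based numbers: vertex suc j, the j-th leaf, is numbered j + 2.
  Chord : ℕ → ℕ → Set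
  Chord i j = ∃[ t ] let a = ℕ.suc (toℕ {k} t) in (ℕ.suc (ℕ.suc i) ≡ 2 ℕ.* a × ℕ.suc (ℕ.suc j) ≡ 2 ℕ.* a ℕ.+ 1)

  -- The offset 2 of the leaf numbers cancels against the offset 1 of the chord index: i + 2 = 2 (t
  -- + 1) gives i = 2t.
  chord⇒ : ∀ {i j} → Chord i j → ∃[ a ] (a ℕ.< k × i ≡ 2 ℕ.* a × j ≡ ℕ.suc (2 ℕ.* a))
  chord⇒ (t , p , q) = toℕ t , toℕ<n t
    , ℕ.suc-injective (ℕ.suc-injective (trans p (ℕ.*-suc 2 (toℕ t))))
    , ℕ.suc-injective (ℕ.suc-injective (trans q (trans (ℕ.+-comm _ 1) (cong ℕ.suc (ℕ.*-suc 2 (toℕ t))))))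

  ⇒chord : ∀ {a} → a ℕ.< k → Chord (2 ℕ.* a) (ℕ.suc (2 ℕ.* a))
  ⇒chord {a} a<k = fromℕ< a<k
    , trans (sym (ℕ.*-suc 2 a)) (cong (λ t → 2 ℕ.* ℕ.suc t) (sym (toℕ-fromℕ< a<k)))
    , trans (trans (cong ℕ.suc (sym (ℕ.*-suc 2 a))) (ℕ.+-comm 1 _))
        (cong (λ t → 2 ℕ.* ℕ.suc t ℕ.+ 1) (sym (toℕ-fromℕ< a<k)))

  -- A spoke has an end numbered 1, which no leaf is.
  leaf-adj : ∀ {i j} → Adj (suc i) (suc j) → Chord (toℕ i) (toℕ j) ⊎ Chord (toℕ j) (toℕ i)
  leaf-adj (inj₁ (inj₂ c)) = inj₁ c
  leaf-adj (inj₂ (inj₂ c)) = inj₂ c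

  2a+1<K : ∀ {a} → a ℕ.< k → ℕ.suc (2 ℕ.* a) ℕ.< K
  2a+1<K {a} a<k = subst (ℕ._≤ K) (ℕ.*-suc 2 a) (ℕ.*-monoʳ-≤ 2 a<k)

  chord-<K : ∀ {i j} → Chord i j → i ℕ.< K × j ℕ.< K
  chord-<K c with chord⇒ c
  ... | a , a<k , refl , refl = ℕ.<-trans (ℕ.n<1+n _) (2a+1<K a<k) , 2a+1<K a<k

  2a<K⇒a<k : ∀ {a} → 2 ℕ.* a ℕ.< K → a ℕ.< k
  2a<K⇒a<k {a} = ℕ.*-cancelˡ-< 2 a k

  -- With leaves counted from 0, chord `a` joins `2a` and `2a + 1`, so the neighbour is the
  -- successor or the predecessor according to parity. The bound `2k≤N` makes it a vertex.
  partner : ∀ i → toℕ i ℕ.< K → ∃[ j ]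
    (toℕ {N} j ℕ.< K × Adj (suc i) (suc j) × (∀ j′ → Adj (suc i) (suc j′) → j′ ≡ j))
  partner i i<K with parity (toℕ i)
  ... | a , inj₁ i≡ = j , subst (ℕ._< K) (sym j≡) j<K
      , inj₁ (inj₂ (subst₂ Chord (sym i≡) (sym j≡) (⇒chord a<k)))
      , λ j′ adj → toℕ-injective (trans (unique (leaf-adj adj)) (sym j≡))
    where
    a<k : a ℕ.< k
    a<k = 2a<K⇒a<k (subst (ℕ._< K) i≡ i<K)
    j<K : ℕ.suc (2 ℕ.* a) ℕ.< K
    j<K = 2a+1<K a<k
    j : Fin N
    j = fromℕ< (ℕ.<-≤-trans j<K 2k≤N)
    j≡ : toℕ j ≡ ℕ.suc (2 ℕ.* a)
    j≡ = toℕ-fromℕ< _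
    unique : ∀ {m} → Chord (toℕ i) m ⊎ Chord m (toℕ i) → m ≡ ℕ.suc (2 ℕ.* a)
    unique (inj₁ c) with chord⇒ c
    ... | b , _ , p , refl = cong (ℕ.suc ∘ (2 ℕ.*_)) (ℕ.*-cancelˡ-≡ b a 2 (trans (sym p) i≡))
    unique (inj₂ c) with chord⇒ c
    ... | b , _ , _ , p = contradiction (trans (sym i≡) p) (ℕ.even≢odd a b)
  ... | a , inj₂ i≡ = j , subst (ℕ._< K) (sym j≡) j<K
      , inj₂ (inj₂ (subst₂ Chord (sym j≡) (sym i≡) (⇒chord a<k)))
      , λ j′ adj → toℕ-injective (trans (unique (leaf-adj adj)) (sym j≡))
    where
    j<K : 2 ℕ.* a ℕ.< K
    j<K = ℕ.<-trans (ℕ.n<1+n _) (subst (ℕ._< K) i≡ i<K)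
    a<k : a ℕ.< k
    a<k = 2a<K⇒a<k j<K
    j : Fin N
    j = fromℕ< (ℕ.<-≤-trans j<K 2k≤N)
    j≡ : toℕ j ≡ 2 ℕ.* a
    j≡ = toℕ-fromℕ< _
    unique : ∀ {m} → Chord (toℕ i) m ⊎ Chord m (toℕ i) → m ≡ 2 ℕ.* a
    unique (inj₂ c) with chord⇒ c
    ... | b , _ , refl , p = cong (2 ℕ.*_) (ℕ.*-cancelˡ-≡ b a 2 (ℕ.suc-injective (trans (sym p) i≡)))
    unique (inj₁ c) with chord⇒ c
    ... | b , _ , p , _ = contradiction (trans (sym p) i≡) (ℕ.even≢odd b a)

  module _ (c d e : ℝ) where

    weights : Fin (ℕ.suc N) → ℝ
    weights zero    = c
    weights (suc j) = step K d e (toℕ j)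

    row-centre : row weights zero ≃ fromℕ K * d + fromℕ (N ∸ K) * e
    row-centre = ≃-trans
      (Rℝ.+-cong (𝟙-no (adj? zero zero) (irrefl refl) c)
        (sum-cong-≋ {N} λ j → 𝟙-yes (adj? zero (suc j)) (inj₁ (inj₁ (refl , ℕ.s≤s (ℕ.s≤s ℕ.z≤n)))) (step K d e (toℕ j))))
      (≃-trans (Rℝ.+-identityˡ _) (sum-step d e 2k≤N))

    row-leaf : ∀ i {x} → sum {N} (λ j → A (suc i) (suc j) * step K d e (toℕ j)) ≃ x →
      row weights (suc i) ≃ c + x
    row-leaf i = Rℝ.+-cong (𝟙-yes (adj? (suc i) zero) (inj₂ (inj₁ (refl , ℕ.s≤s (ℕ.s≤s ℕ.z≤n)))) c)

    row-paired : ∀ i → toℕ i ℕ.< K → row weights (suc i) ≃ c + d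
    row-paired i i<K with partner i i<K
    ... | j , j<K , i~j , unique = row-leaf i (≃-trans
      (sum-single j λ j′ j′≢j → 𝟙-no (adj? (suc i) (suc j′)) (j′≢j ∘ unique j′) _)
      (≃-trans (𝟙-yes (adj? (suc i) (suc j)) i~j _) (Rℝ.reflexive (step-< d e j<K))))

    row-unpaired : ∀ i → ¬ toℕ i ℕ.< K → row weights (suc i) ≃ c
    row-unpaired i i≮K = ≃-trans (row-leaf i (sum-zero λ j → 𝟙-no (adj? (suc i) (suc j)) (¬adj j) _))
      (Rℝ.+-identityʳ c)
      where
      ¬adj : ∀ j → ¬ Adj (suc i) (suc j)
      ¬adj j adj with leaf-adj adj
      ... | inj₁ ch = i≮K (proj₁ (chord-<K ch))
      ... | inj₂ ch = i≮K (proj₂ (chord-<K ch))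

    -- The centre, the leaves on chords and the other leaves form an equitable partition, so one
    -- equation per class suffices. The chord equation is conditional on `0 < K` so that the
    -- all-ones vector qualifies when n = 2.
    weights-eigenvector : ∀ {y} → fromℕ K * d + fromℕ (N ∸ K) * e ≃ y * c →
      (0 ℕ.< K → c + d ≃ y * d) → c ≃ y * e → RealEigenvector y weights
    weights-eigenvector {y} centre paired unpaired zero = ≃-trans row-centre centre
    weights-eigenvector {y} centre paired unpaired (suc i) with toℕ i ℕ.<? K
    ... | yes i<K = ≃-trans (row-paired i i<K) (≃-trans (paired (ℕ.≤-<-trans ℕ.z≤n i<K))
                      (Rℝ.*-congˡ (Rℝ.reflexive (sym (step-< d e i<K)))))
    ... | no  i≮K = ≃-trans (row-unpaired i i≮K) (≃-trans unpaired
                      (Rℝ.*-congˡ (Rℝ.reflexive (sym (step-≮ d e i≮K)))))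

    weights-pos : 0ℝ ≺ c → 0ℝ ≺ d → 0ℝ ≺ e → ∀ i → 0ℝ ≺ weights i
    weights-pos 0≺c 0≺d 0≺e zero = 0≺c
    weights-pos 0≺c 0≺d 0≺e (suc i) with does (toℕ i ℕ.<? K)
    ... | true  = 0≺d
    ... | false = 0≺e

-- The cubic

fromℕ-mono-≲ : ∀ {m n} → m ℕ.≤ n → fromℕ m ≲ fromℕ n
fromℕ-mono-≲ m≤n = fromℚ-mono-≲ (ι-mono m≤n)

fromℕ-nonneg : ∀ n → 0ℝ ≲ fromℕ n
fromℕ-nonneg n = fromℕ-mono-≲ {0} {n} ℕ.z≤n

fromℚ-cancel-≲ : ∀ {p q} → fromℚ p ≲ fromℚ q → p ℚ.≤ q
fromℚ-cancel-≲ h = ℚ.≮⇒≥ λ q<p → ≲⇒⊁ h (fromℚ-mono-≺ q<p)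

fromℕ-2* : ∀ k → fromℕ (2 ℕ.* k) ≃ fromℕ k + fromℕ k
fromℕ-2* k = ≃-trans (fromℕ-+ k (k ℕ.+ 0))
  (Rℝ.+-congˡ (≃-trans (fromℕ-+ k 0) (Rℝ.+-identityʳ (fromℕ k))))

0≺1 : 0ℝ ≺ 1ℝ
0≺1 = fromℚ-mono-≺ (ℚ.positive⁻¹ 1ℚ)

module Cubic (N k : ℕ) (2k≤N : 2 ℕ.* k ℕ.≤ N) where

  open AdjacencyRows N k 2k≤N

  private
    n : ℕ
    n = ℕ.suc N
    ν κ : ℝ
    ν = fromℕ N
    κ = fromℕ (2 ℕ.* k)

  cubic-factored : ∀ x → cubic n k x ≃ (x - 1ℝ) * (x * x - ν) - κ
  cubic-factored x = ≃-trans
    (Rℝ.+-congʳ (Rℝ.+-congʳ (Rℝ.+-cong (Rℝ.+-congˡ (Rℝ.-‿cong (Rℝ.*-congʳ (Rℝ.+-congʳ n≃1+ν)))) n≃1+ν)))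
    (solve 3 (λ x ν κ → x :* (x :* (x :* con 1ℚ)) :- x :* (x :* con 1ℚ)
        :- ((con 1ℚ :+ ν) :- con 1ℚ) :* x :+ (con 1ℚ :+ ν) :- con 1ℚ :- κ
      := (x :- con 1ℚ) :* (x :* x :- ν) :- κ) ≃-refl x ν κ)
    where
    n≃1+ν : fromℕ n ≃ 1ℝ + ν
    n≃1+ν = fromℕ-+ 1 N

  cubic-cong : ∀ {x y} → x ≃ y → cubic n k x ≃ cubic n k y
  cubic-cong {x} {y} e = ≃-trans (cubic-factored x) (≃-trans
    (Rℝ.+-congʳ (Rℝ.*-cong (Rℝ.+-congʳ e) (Rℝ.+-congʳ (Rℝ.*-cong e e)))) (≃-sym (cubic-factored y)))

  root-equation : ∀ {x} → cubic n k x ≃ 0ℝ → (x - 1ℝ) * (x * x - ν) ≃ κ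
  root-equation {x} e = ≃-trans
    (solve 2 (λ p κ → p := (p :- κ) :+ κ) ≃-refl ((x - 1ℝ) * (x * x - ν)) κ)
    (≃-trans (Rℝ.+-congʳ (≃-trans (≃-sym (cubic-factored x)) e)) (Rℝ.+-identityˡ κ))

  -- Gives the left end of the bisection: in `cubic-factored` the product is nonpositive here, and
  -- `κ` is subtracted from it.
  cubic-nonpos : ∀ {x} → 1ℝ ≲ x → x * x ≲ ν → cubic n k x ≲ 0ℝ
  cubic-nonpos {x} 1≲x x²≲ν = 0≲⇒≲ (≲-resp ≃-refl
    (≃-trans (solve 3 (λ x ν κ → (x :- con 1ℚ) :* (ν :- x :* x) :+ κ
                 := con 0ℚ :- ((x :- con 1ℚ) :* (x :* x :- ν) :- κ)) ≃-refl x ν κ)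
             (Rℝ.+-congˡ (Rℝ.-‿cong (≃-sym (cubic-factored x)))))
    (+-nonneg (*-nonneg (≲⇒0≲ 1≲x) (≲⇒0≲ x²≲ν)) (fromℕ-nonneg (2 ℕ.* k))))

  -- Gives the right end of the bisection: at `ν + 1` the cubic equals ν²(ν + 1) + (ν - κ), and `κ`
  -- is at most `ν`.
  cubic-at-n-nonneg : 0ℝ ≲ cubic n k (fromℕ n)
  cubic-at-n-nonneg = ≲-resp ≃-refl
    (≃-trans (solve 2 (λ ν κ → ν :* ν :* (ν :+ con 1ℚ) :+ (ν :- κ)
                := (con 1ℚ :+ ν :- con 1ℚ) :* ((con 1ℚ :+ ν) :* (con 1ℚ :+ ν) :- ν) :- κ) ≃-refl ν κ)
    (≃-trans (≃-sym (cubic-factored (1ℝ + ν))) (cubic-cong (≃-sym (fromℕ-+ 1 N)))))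
    (+-nonneg (*-nonneg (*-nonneg 0≲ν 0≲ν) (+-nonneg 0≲ν (≺⇒≲ 0≺1))) (≲⇒0≲ (fromℕ-mono-≲ {2 ℕ.* k} {N} 2k≤N)))
    where
    0≲ν : 0ℝ ≲ ν
    0≲ν = fromℕ-nonneg N

  root-above : ∀ {q} → q ℚ.≤ ι n → cubic n k (fromℚ q) ≲ 0ℝ → ∃[ x ] (cubic n k x ≃ 0ℝ × fromℚ q ≲ x)
  root-above {q} q≤n f≲0 =
    -- The cubic acts termwise on sequences, so its rational version is read off at index 0 of a
    -- constant sequence.
    let x , fx≃0 , q≲x , _ = intermediate-value (cubic n k) (λ p → seq (cubic n k (fromℚ p)) 0)
          cubic-cong (λ _ _ → refl) q≤n
          (fromℚ-cancel-≲ (≲-resp (≃-pointwise λ _ → refl) ≃-refl f≲0))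
          (fromℚ-cancel-≲ (≲-resp ≃-refl (≃-pointwise λ _ → refl) cubic-at-n-nonneg))
    in x , fx≃0 , q≲x

  -- The eigenvalue equation at the centre is the cubic.
  root⇒eigenvector : ∀ {y} → cubic n k y ≃ 0ℝ → 1ℝ ≺ y →
    ∃[ w ] ((∀ i → 0ℝ ≺ w i) × RealEigenvector y w)
  root⇒eigenvector {y} fy≃0 1≺y = weights (y * (y - 1ℝ)) y (y - 1ℝ)
    , weights-pos _ _ _ (*-pos 0≺y 0≺y-1) 0≺y 0≺y-1
    , weights-eigenvector _ _ _ centre
        (λ _ → solve 1 (λ y → y :* (y :- con 1ℚ) :+ y := y :* y) ≃-refl y) ≃-refl
    where
    0≺y : 0ℝ ≺ y
    0≺y = ≺-trans 0≺1 1≺y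
    0≺y-1 : 0ℝ ≺ y - 1ℝ
    0≺y-1 = ≺⇒0≺ 1≺y
    ν≃ : ν ≃ κ + fromℕ (N ∸ 2 ℕ.* k)
    ν≃ = ≃-trans (Rℝ.reflexive (cong fromℕ (sym (ℕ.m+[n∸m]≡n 2k≤N)))) (fromℕ-+ (2 ℕ.* k) (N ∸ 2 ℕ.* k))
    centre : κ * y + fromℕ (N ∸ 2 ℕ.* k) * (y - 1ℝ) ≃ y * (y * (y - 1ℝ))
    centre = begin
      κ * y + m * (y - 1ℝ)
        ≈⟨ solve 3 (λ y κ m → κ :* y :+ m :* (y :- con 1ℚ) := κ :+ (y :- con 1ℚ) :* (κ :+ m)) ≃-refl y κ m ⟩
      κ + (y - 1ℝ) * (κ + m)
        ≈⟨ Rℝ.+-cong (≃-sym (root-equation fy≃0)) (Rℝ.*-congˡ (≃-sym ν≃)) ⟩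
      (y - 1ℝ) * (y * y - ν) + (y - 1ℝ) * ν
        ≈⟨ solve 2 (λ y ν → (y :- con 1ℚ) :* (y :* y :- ν) :+ (y :- con 1ℚ) :* ν := y :* (y :* (y :- con 1ℚ))) ≃-refl y ν ⟩
      y * (y * (y - 1ℝ)) ∎
      where
      open ≃-Reasoning
      m : ℝ
      m = fromℕ (N ∸ 2 ℕ.* k)

  -- A root above `μ` would exceed 1, where `root⇒eigenvector` makes it an eigenvalue, against the
  -- maximality of `μ`.
  root≲μ : ∀ μ {y} → Isμ (S n k) μ → 1ℝ ≲ μ → cubic n k y ≃ 0ℝ → y ≲ μ
  root≲μ μ {y} isμ 1≲μ fy≃0 = ⊀⇒≲ λ μ≺y →
    let w , 0≺w , Aw = root⇒eigenvector fy≃0 (≲-≺-trans 1≲μ μ≺y)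
    in ≲⇒⊁ (realEigenvalue≲μ {μ} isμ {y} {w} Aw (λ w≃0 → ≲⇒⊁ (≃⇒≲ (w≃0 zero)) (0≺w zero))) μ≺y

  root⇒Isμ : ∀ {y} → cubic n k y ≃ 0ℝ → 1ℝ ≺ y → Isμ (S n k) y
  root⇒Isμ fy≃0 1≺y = let w , 0≺w , Aw = root⇒eigenvector fy≃0 1≺y in
    positiveEigenvector⇒Isμ (≺⇒≲ (≺-trans 0≺1 1≺y)) 0≺w Aw zero

  spectralRadius : 1 ℕ.≤ N → ∃[ μ ] (Isμ (S n k) μ × cubic n k μ ≃ 0ℝ × 1ℝ ≲ μ)
  spectralRadius 1≤N with ℕ.m≤n⇒m<n∨m≡n 1≤N
  ... | inj₁ 2≤N =
    -- The value 5/4 is a rational above 1 with square at most 2, hence at most `N`; it keeps the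
    -- root strictly above 1.
    let y , fy≃0 , 5/4≲y = root-above {+ 5 ℚ./ 4}
          (ℚ.≤-trans (from-yes (+ 5 ℚ./ 4 ℚ.≤? ι 2)) (ι-mono {2} {n} (ℕ.≤-trans 2≤N (ℕ.n≤1+n N))))
          (cubic-nonpos (fromℚ-mono-≲ (from-yes (1ℚ ℚ.≤? + 5 ℚ./ 4)))
            (≲-trans (≲-pointwise λ _ → from-yes ((+ 5 ℚ./ 4) ℚ.* (+ 5 ℚ./ 4) ℚ.≤? ι 2)) (fromℕ-mono-≲ {2} {N} 2≤N)))
        1≺y = ≺-≲-trans (fromℚ-mono-≺ (from-yes (1ℚ ℚ.<? + 5 ℚ./ 4))) 5/4≲y
    in y , root⇒Isμ fy≃0 1≺y , fy≃0 , ≺⇒≲ 1≺y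
  -- Here `N = 1` forces `k = 0`: the graph is a single edge and the all-ones vector has eigenvalue
  -- 1.
  ... | inj₂ refl = 1ℝ
    , positiveEigenvector⇒Isμ (≺⇒≲ 0≺1) (weights-pos 1ℝ 1ℝ 1ℝ 0≺1 0≺1 0≺1)
        (weights-eigenvector 1ℝ 1ℝ 1ℝ
          (≃-trans (Rℝ.+-cong (Rℝ.*-congʳ κ≃0) (Rℝ.*-congʳ (Rℝ.reflexive (cong (λ j → fromℕ (1 ∸ j)) 2k≡0))))
            (solve 0 (con 0ℚ :* con 1ℚ :+ con 1ℚ :* con 1ℚ := con 1ℚ :* con 1ℚ) ≃-refl))
          (λ 0<2k → contradiction (subst (0 ℕ.<_) 2k≡0 0<2k) λ ())
          (≃-sym (Rℝ.*-identityˡ 1ℝ))) zero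
    , ≃-trans (cubic-factored 1ℝ) (≃-trans (Rℝ.+-congˡ (Rℝ.-‿cong κ≃0))
        (solve 0 ((con 1ℚ :- con 1ℚ) :* (con 1ℚ :* con 1ℚ :- con 1ℚ) :- con 0ℚ := con 0ℚ) ≃-refl))
    , ≲-refl
    where
    2k≡0 : 2 ℕ.* k ≡ 0
    2k≡0 = cong (2 ℕ.*_) (ℕ.n<1⇒n≡0 (ℕ.*-cancelˡ-< 2 k 1 (ℕ.s≤s 2k≤N)))
    κ≃0 : κ ≃ 0ℝ
    κ≃0 = Rℝ.reflexive (cong fromℕ 2k≡0)

  module _ (1≤N : 1 ℕ.≤ N) (μ : ℝ) (isμ : Isμ (S n k) μ) where

    private
      μ₀ : ℝ
      μ₀ = proj₁ (spectralRadius 1≤N)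
      μ≃μ₀ : μ ≃ μ₀
      μ≃μ₀ = Isμ-unique {μ} {μ₀} isμ (proj₁ (proj₂ (spectralRadius 1≤N)))

    -- By uniqueness `μ` equals the constructed radius `μ₀`, so what was shown for `μ₀` transfers.
    1≲μ : 1ℝ ≲ μ
    1≲μ = ≲-resp ≃-refl (≃-sym μ≃μ₀) (proj₂ (proj₂ (proj₂ (spectralRadius 1≤N))))

    μ-root : cubic n k μ ≃ 0ℝ
    μ-root = ≃-trans (cubic-cong μ≃μ₀) (proj₁ (proj₂ (proj₂ (spectralRadius 1≤N))))

  -- If μ > s = √(N + k) ≥ 3, then μ − 1 > 2 and μ² − N > k, against (μ − 1)(μ² − N) = 2k.
  root≲sqrt : ∀ {x s} → cubic n k x ≃ 0ℝ → s * s ≃ fromℕ (N ℕ.+ k) → fromℕ 3 ≲ s → x ≲ s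
  root≲sqrt {x} {s} fx≃0 s² 3≲s = ⊀⇒≲ λ s≺x →
    let k≺t : fromℕ k ≺ x * x - ν
        k≺t = 0≺⇒≺ (≺-resp ≃-refl
          (≃-trans (Rℝ.+-congˡ (Rℝ.-‿cong (≃-trans s² (fromℕ-+ N k))))
            (solve 3 (λ x² ν k → x² :- (ν :+ k) := (x² :- ν) :- k) ≃-refl (x * x) ν (fromℕ k)))
          (≺⇒0≺ (square-mono-≺ (≲-trans (fromℕ-nonneg 3) 3≲s) s≺x)))
        0≲t = ≲-trans (fromℕ-nonneg k) (≺⇒≲ k≺t)
        0≲x-3 = ≲⇒0≲ (≲-trans 3≲s (≺⇒≲ s≺x))
    in ≺-irrefl (≺-≲-trans (0≺⇒≺ (≺-resp ≃-refl
         (≃-trans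
           -- With t = x² - ν, the excess of (x - 1) t over 2k is split into the positive t - k and
           -- two nonnegative terms, t - k and (x - 3) t.
           (solve 3 (λ x t k → (t :- k) :+ ((t :- k) :+ (x :- con (ι 3)) :* t) := (x :- con 1ℚ) :* t :- (k :+ k))
              ≃-refl x (x * x - ν) (fromℕ k))
           (Rℝ.+-congˡ (Rℝ.-‿cong (≃-sym (fromℕ-2* k)))))
         (+-pos (≺⇒0≺ k≺t) (+-nonneg (≺⇒≲ (≺⇒0≺ k≺t)) (*-nonneg 0≲x-3 0≲t)))))
       (≃⇒≲ (root-equation fx≃0)))

-- The largest root and the comparisons with square roots

spectralRadius-largestRoot : ∀ n k → 2 ℕ.≤ n → 2 ℕ.* k ℕ.< n →
  (∃[ μ ] Isμ (S n k) μ) × (∀ μ → Isμ (S n k) μ → IsLargestRoot (cubic n k) μ)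
spectralRadius-largestRoot (ℕ.suc N) k (ℕ.s≤s 1≤N) (ℕ.s≤s 2k≤N) =
  (let μ , isμ , _ = spectralRadius 1≤N in μ , isμ)
  , λ μ isμ → unwrap≈ (μ-root 1≤N μ isμ)
            , λ y fy≈0 → unwrap≤ {y} {μ} (root≲μ μ isμ (1≲μ 1≤N μ isμ) (wrap≈ fy≈0))
  where open Cubic N k 2k≤N

spectralRadius≤sqrt : ∀ n k → 2 ℕ.* k ℕ.< n → 9 ℕ.≤ (n ∸ 1) ℕ.+ k → ∀ μ → Isμ (S n k) μ →
  ∃[ s ] (IsSqrt (fromℕ ((n ∸ 1) ℕ.+ k)) s × μ ≤ s)
-- A single vertex forces `k = 0`, and then n - 1 + k is below 9; the last clause thus has n ≥ 2, as
-- `μ-root` requires.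
spectralRadius≤sqrt (ℕ.suc ℕ.zero) ℕ.zero _ () μ isμ
spectralRadius≤sqrt (ℕ.suc ℕ.zero) (ℕ.suc k) (ℕ.s≤s ()) _ μ isμ
spectralRadius≤sqrt (ℕ.suc N@(ℕ.suc _)) k (ℕ.s≤s 2k≤N) 9≤c μ isμ =
  -- From 9 ≤ c the root of c lies between 3 and c; the lower bound 3 is what `root≲sqrt` uses.
  let s , s² , 3≲s , _ = sqrt-between (ι c) {ι 3} {ι c} (ι-mono {0} {3} ℕ.z≤n)
        (ι-mono {3} {c} (ℕ.≤-trans (ℕ.m≤m+n 3 6) 9≤c)) (ι-mono {9} {c} 9≤c) ιc≤ιc²
  in s , (unwrap≤ (≲-trans (fromℕ-nonneg 3) 3≲s) , unwrap≈ s²)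
       , unwrap≤ (root≲sqrt (μ-root (ℕ.s≤s ℕ.z≤n) μ isμ) s² 3≲s)
  where
  open Cubic N k 2k≤N
  c : ℕ
  c = N ℕ.+ k
  ιc≤ιc² : ι c ℚ.≤ ι c ℚ.* ι c
  ιc≤ιc² = subst (ℚ._≤ ι c ℚ.* ι c) (ℚ.*-identityˡ (ι c))
    (ℚ.*-monoʳ-≤-nonNeg (ι c) {{ℚ.nonNegative (ι-mono {0} {c} ℕ.z≤n)}} (ι-mono {1} {c} (ℕ.s≤s ℕ.z≤n)))

-- Two rationals separate the sides: √n ≤ q < r ≤ y ≤ μ, where `y` is a root found between `r` and n
-- because the cubic is nonpositive at `r`.
sqrt<μ : ∀ N {q r} → 2 ℕ.≤ N → ∀ μ → Isμ (S (ℕ.suc N) 1) μ →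
  1ℚ ℚ.≤ q → ι (ℕ.suc N) ℚ.≤ q ℚ.* q → q ℚ.< r → r ℚ.≤ ι (ℕ.suc N) →
  seq (cubic (ℕ.suc N) 1 (fromℚ r)) 0 ℚ.≤ 0ℚ →
  ∃[ s ] (IsSqrt (fromℕ (ℕ.suc N)) s × s < μ)
sqrt<μ N 2≤N μ isμ 1≤q n≤q² q<r r≤n fr≤0 =
  let s , s² , 1≲s , s≲q = sqrt-between (ι (ℕ.suc N)) (ℚ.nonNegative⁻¹ 1ℚ) 1≤q
        (ι-mono {1} {ℕ.suc N} (ℕ.s≤s ℕ.z≤n)) n≤q²
      y , fy≃0 , r≲y = root-above r≤n (≲-pointwise λ _ → fr≤0)
  in s , (unwrap≤ (≲-trans (≺⇒≲ 0≺1) 1≲s) , unwrap≈ s²)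
       , unwrap< (≺-≲-trans (≲-≺-trans s≲q (fromℚ-mono-≺ q<r))
           (≲-trans r≲y (root≲μ μ isμ (1≲μ (ℕ.≤-trans (ℕ.n≤1+n 1) 2≤N) μ isμ) fy≃0)))
  where open Cubic N 1 2≤N

-- For concrete numbers the implicit `True` argument is solved by evaluation, so the inequality is
-- checked by computation.
decideℕ : ∀ {m n} {_ : True (m ℕ.≤? n)} → m ℕ.≤ n
decideℕ {_} {_} {t} = toWitness t

decide≤ : ∀ {p q} {_ : True (p ℚ.≤? q)} → p ℚ.≤ q
decide≤ {_} {_} {t} = toWitness t

decide< : ∀ {p q} {_ : True (p ℚ.<? q)} → p ℚ.< q
decide< {_} {_} {t} = toWitness t

sqrt<spectralRadius : ∀ n → 4 ℕ.≤ n → n ℕ.≤ 8 → ∀ μ → Isμ (S n 1) μ → ∃[ s ] (IsSqrt (fromℕ n) s × s < μ)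
sqrt<spectralRadius 1 (ℕ.s≤s ())
sqrt<spectralRadius 2 (ℕ.s≤s (ℕ.s≤s ()))
sqrt<spectralRadius 3 (ℕ.s≤s (ℕ.s≤s (ℕ.s≤s ())))
-- In each case `q` is √n, rounded up to hundredths when irrational, and `r` is slightly larger, by
-- 1/10 for n = 4 and by 1/100 afterwards, with (r - 1)(r² - (n - 1)) still at most 2.
sqrt<spectralRadius 4 _ _ μ isμ = sqrt<μ 3 {+ 2 ℚ./ 1} {+ 21 ℚ./ 10} decideℕ μ isμ
  decide≤ decide≤ decide< decide≤ decide≤
sqrt<spectralRadius 5 _ _ μ isμ = sqrt<μ 4 {+ 224 ℚ./ 100} {+ 225 ℚ./ 100} decideℕ μ isμ
  decide≤ decide≤ decide< decide≤ decide≤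
sqrt<spectralRadius 6 _ _ μ isμ = sqrt<μ 5 {+ 245 ℚ./ 100} {+ 246 ℚ./ 100} decideℕ μ isμ
  decide≤ decide≤ decide< decide≤ decide≤
sqrt<spectralRadius 7 _ _ μ isμ = sqrt<μ 6 {+ 265 ℚ./ 100} {+ 266 ℚ./ 100} decideℕ μ isμ
  decide≤ decide≤ decide< decide≤ decide≤
sqrt<spectralRadius 8 _ _ μ isμ = sqrt<μ 7 {+ 283 ℚ./ 100} {+ 284 ℚ./ 100} decideℕ μ isμ
  decide≤ decide≤ decide< decide≤ decide≤
sqrt<spectralRadius (ℕ.suc (ℕ.suc (ℕ.suc (ℕ.suc (ℕ.suc (ℕ.suc (ℕ.suc (ℕ.suc (ℕ.suc n))))))))) _
  (ℕ.s≤s (ℕ.s≤s (ℕ.s≤s (ℕ.s≤s (ℕ.s≤s (ℕ.s≤s (ℕ.s≤s (ℕ.s≤s ())))))))) μ isμ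

lemma6 : (∀ n k → 2 ℕ.≤ n → 2 ℕ.* k ℕ.< n →
    (∃[ μ ] Isμ (S n k) μ)
    × (∀ μ → Isμ (S n k) μ → IsLargestRoot (cubic n k) μ))
    × (∀ n k → 2 ℕ.* k ℕ.< n → 9 ℕ.≤ (n ∸ 1) ℕ.+ k →
    ∀ μ → Isμ (S n k) μ →
    ∃[ s ] (IsSqrt (fromℕ ((n ∸ 1) ℕ.+ k)) s × μ ≤ s))
    × (∀ n → 4 ℕ.≤ n → n ℕ.≤ 8 →
    ∀ μ → Isμ (S n 1) μ →
    ∃[ s ] (IsSqrt (fromℕ n) s × s < μ))
lemma6 = spectralRadius-largestRoot , spectralRadius≤sqrt , sqrt<spectralRadius
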